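{- For every prime $p$ and every positive integer $n$, $$P'(\underbrace{p,p,\ldots,p}_{n})\equiv P'(\underbrace{1,1,\ldots,1}_{n})\pmod{p^3}.$$
   Context: $P'(t_1,\dots,t_n)$ is the number of anagrams without fixed letters of the word $1^{t_1}2^{t_2}\cdots n^{t_n}$ (letter $i$ repeated $t_i$ times, in this order), i.e. the number of words $a_{1,1}\ldots a_{1,t_1}\ldots a_{n,1}\ldots a_{n,t_n}$ that are rearrangements of $1^{t_1}\cdots n^{t_n}$ with $a_{i,j}\neq i$ for all $i,j$. In particular $P'(1,\dots,1)$ ($n$ ones) is the number $d(n)$ of derangements of $n$ elements. -}

module Defs where

open import Data.Nat using (ℕ; zero; suc)
open import Data.Bool using (Bool; true; false; _∧_; not)
open import Data.Fin using (Fin)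
open import Data.Fin.Properties using (_≟_)
open import Data.List using (List; []; _∷_; length; filter; concatMap; replicate; allFin; map; all)
open import Data.Nat.Properties using () renaming (_≟_ to _≟ℕ_)
open import Relation.Nullary.Decidable using (⌊_⌋; T?; yes; no)
open import Function using (_∘_)

allWords : (n N : ℕ) → List (List (Fin n))
allWords n zero    = [] ∷ []
allWords n (suc N) = concatMap (λ a → map (a ∷_) (allWords n N)) (allFin n)

baseWord : (n : ℕ) → (Fin n → ℕ) → List (Fin n)
baseWord n t = concatMap (λ i → replicate (t i) i) (allFin n)

occ : {n : ℕ} → Fin n → List (Fin n) → ℕ
occ a []       = zero
occ a (b ∷ w)  with a ≟ b
... | yes _ = suc (occ a w)
... | no  _ = occ a w

isRearrangement : {n : ℕ} → List (Fin n) → List (Fin n) → Bool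
isRearrangement {n} w v = all (λ a → ⌊ occ a w ≟ℕ occ a v ⌋) (allFin n)

noFixedLetter : {n : ℕ} → List (Fin n) → List (Fin n) → Bool
noFixedLetter []      []      = true
noFixedLetter (a ∷ w) (b ∷ v) = not ⌊ a ≟ b ⌋ ∧ noFixedLetter w v
noFixedLetter _       _       = false

P′ : (n : ℕ) → (Fin n → ℕ) → ℕ
P′ n t = length (filter (λ w → T? (isRearrangement w v ∧ noFixedLetter w v))
                        (allWords n (length v)))
  where v = baseWord n t

{-# OPTIONS --safe #-}

-- P′(t,…,t) is the coefficient of Π x_aᵗ in Π_b Q_bᵗ, where Q_b = Σ_{a≠b} x_a. For t = p prime, put
-- y_a = x_aᵖ; then Q_bᵖ = A_b + p B_b with A_b = Σ_{a≠b} y_a, and B_b has only monomials involving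
-- at least two letters. Modulo p³ only the terms with at most two factors B survive:
--   * Π A_b contributes the number of derangements;
--   * a single B_i contributes nothing, as its exponents are not all divisible by p;
--   * in B_i B_j the only monomials with exponents divisible by p are the y_a y_b with i, j, a, b
--     distinct, all with the same coefficient w = Σ_{0<k<p} (C(p,k)/p)². The remaining factors
--     complete each of them in a number of ways that depends only on n, so the total is a multiple of
--     p² C(n,2) C(n-2,2) w = 6 p² C(n,4) w.
-- Finally C(p,k)/p ≡ ±1/k gives 6w ≡ 6 Σ 1/k² ≡ 6 Σ k² = (p-1) p (2p-1) ≡ 0 (mod p).
module Submission where

open import Defs
open import Algebra.Bundles using (CommutativeSemiring)
open import Algebra.Core using (Op₂)
open import Algebra.Structures using (IsCommutativeMonoid)
open import Algebra.Structures.Biased using (isCommutativeSemiringˡ)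
open import Data.Bool using (Bool; true; false; T; if_then_else_; not; _∧_)
open import Data.Bool.ListAction using (all; and)
open import Data.Fin as Fin using (Fin; zero; suc; toℕ; opposite)
open import Data.Fin.Permutation using (Permutation; permutation)
open import Data.Fin.Properties as Finₚ using (_≟_)
import Data.Integer as ℤ
import Data.Integer.Properties as ℤ
open import Data.List as List using (List; []; _∷_; _++_; map; length; filter; allFin; concatMap)
open import Data.List.Membership.Propositional.Properties using (∈-∃++; ∈-allFin)
open import Data.List.Properties using (filter-all; filter-reject; length-tabulate; map-cong; ++-identityʳ)
open import Data.List.Relation.Binary.Permutation.Propositional using (_↭_; prep; swap; ↭-refl; ↭-sym; ↭-trans; ↭-reflexive; ↭⇒↭ₛ)
open import Data.List.Relation.Binary.Permutation.Propositional.Properties using (shift; ++-comm; ++⁺ˡ; ↭-length; filter-↭)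
open import Data.List.Relation.Binary.Permutation.Setoid.Properties using (Unique-resp-↭)
open import Data.List.Relation.Unary.All as All using (All; []; _∷_)
import Data.List.Relation.Unary.All.Properties as Allₚ
open import Data.List.Relation.Unary.AllPairs using ([]; _∷_)
open import Data.List.Relation.Unary.Unique.Propositional using (Unique)
open import Data.List.Relation.Unary.Unique.Propositional.Properties using (allFin⁺)
open import Data.Nat as ℕ using (ℕ; zero; suc; pred; _∸_; _≥_; NonZero; ≢-nonZero)
open import Data.Nat.Combinatorics using (_C_; nCn≡1; nC1≡n; k>n⇒nCk≡0; nCk≡nC[n∸k]; nCk+nC[k+1]≡[n+1]C[k+1])
open import Data.Nat.DivMod
open import Data.Nat.Primality using (Prime; euclidsLemma; ¬prime[0])
import Data.Nat.Properties as ℕ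
open import Data.Nat.Tactic.RingSolver using (solve-∀)
open import Data.Product using (_,_)
open import Data.Sum using (inj₁; inj₂)
open import Data.Vec as Vec using (Vec; lookup; zipWith; replicate; _[_]≔_)
import Data.Vec.Properties as Vecₚ
open import Level using (0ℓ)
open import Relation.Binary using (IsEquivalence)
open import Relation.Binary.PropositionalEquality as ≡ using (_≡_)
open import Relation.Nullary using (¬_; contradiction; yes; no; ¬?)
open import Relation.Nullary.Decidable using (⌊_⌋; T?; toWitness; fromWitness)
import Algebra.Properties.Semiring.Sum ℕ.+-*-semiring as ℕSum

-- Everything is computed exactly over ℕ. The relation A_b = s - y_b, with s the sum of all y_a,
-- enters in the additive form s = y_b + A_b, and P′(p,...,p) comes out as the derangement number
-- plus p² times an explicit number plus p³ times a coefficient that is never evaluated. The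
-- obstacle is that deleting the monomials whose exponents are not all divisible by p does not
-- respect products: B_i itself is deleted, while B_i B_j need not be. The deletion does respect
-- multiplication by y_a, and this suffices, because all factors other than the B's are sums of y_a.
-- The completions of y_a y_b in B_i B_j can be counted uniformly: rows a and b no longer forbid
-- anything, as their letters are used up, and the letters i and j are forbidden in no remaining
-- row. So n-2 rows receive n-2 letters under n-4 prohibitions. The factor 6 from C(n,2) C(n-2,2) =
-- 6 C(n,4) is essential for small primes: w is 1 for p = 2 and 2 for p = 3.

module ListOperations {r ℓ} (R : CommutativeSemiring r ℓ) where
  open CommutativeSemiring R hiding (zero) renaming (refl to ≈-refl; sym to ≈-sym; trans to ≈-trans)
  open import Algebra.Properties.Semiring.Exp semiring public
  open import Algebra.Properties.Semiring.Mult semiring public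
  open import Algebra.Properties.Semiring.Sum semiring public
  open import Algebra.Solver.Ring.NaturalCoefficients.Default R using (solve; _:=_; _:+_; _:*_)
  open import Algebra.Properties.CommutativeSemiring.Binomial R using (theorem; binomialTerm)
  open import Relation.Binary.Reasoning.Setoid setoid

  -- Sums and products over lists, expansion in powers of π, Frobenius with remainder.

  ∑ₗ ∏ₗ : ∀ {a} {A : Set a} → (A → Carrier) → List A → Carrier
  ∑ₗ f []       = 0#
  ∑ₗ f (a ∷ as) = f a + ∑ₗ f as
  ∏ₗ f []       = 1#
  ∏ₗ f (a ∷ as) = f a * ∏ₗ f as

  module _ {a} {A : Set a} (f : A → Carrier) where

    ∑ₗ-↭ : ∀ {as bs} → as ↭ bs → ∑ₗ f as ≈ ∑ₗ f bs
    ∑ₗ-↭ _↭_.refl         = ≈-refl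
    ∑ₗ-↭ (prep a e)   = +-congˡ (∑ₗ-↭ e)
    ∑ₗ-↭ (swap {as} {bs} a b e) = ≈-trans (+-congˡ (+-congˡ (∑ₗ-↭ e)))
      (solve 3 (λ a b s → a :+ (b :+ s) := b :+ (a :+ s)) ≈-refl (f a) (f b) (∑ₗ f bs))
    ∑ₗ-↭ (_↭_.trans e e′) = ≈-trans (∑ₗ-↭ e) (∑ₗ-↭ e′)

    ∏ₗ-↭ : ∀ {as bs} → as ↭ bs → ∏ₗ f as ≈ ∏ₗ f bs
    ∏ₗ-↭ _↭_.refl         = ≈-refl
    ∏ₗ-↭ (prep a e)   = *-congˡ (∏ₗ-↭ e)
    ∏ₗ-↭ (swap {as} {bs} a b e) = ≈-trans (*-congˡ (*-congˡ (∏ₗ-↭ e)))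
      (solve 3 (λ a b s → a :* (b :* s) := b :* (a :* s)) ≈-refl (f a) (f b) (∏ₗ f bs))
    ∏ₗ-↭ (_↭_.trans e e′) = ≈-trans (∏ₗ-↭ e) (∏ₗ-↭ e′)

    ∑ₗ-++ : ∀ as bs → ∑ₗ f (as ++ bs) ≈ ∑ₗ f as + ∑ₗ f bs
    ∑ₗ-++ []       bs = ≈-sym (+-identityˡ _)
    ∑ₗ-++ (a ∷ as) bs = ≈-trans (+-congˡ (∑ₗ-++ as bs)) (≈-sym (+-assoc _ _ _))

    ∏ₗ-++ : ∀ as bs → ∏ₗ f (as ++ bs) ≈ ∏ₗ f as * ∏ₗ f bs
    ∏ₗ-++ []       bs = ≈-sym (*-identityˡ _)
    ∏ₗ-++ (a ∷ as) bs = ≈-trans (*-congˡ (∏ₗ-++ as bs)) (≈-sym (*-assoc _ _ _))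

    ∏ₗ-cong : ∀ {g} → (∀ a → f a ≈ g a) → ∀ as → ∏ₗ f as ≈ ∏ₗ g as
    ∏ₗ-cong e []       = ≈-refl
    ∏ₗ-cong e (a ∷ as) = *-cong (e a) (∏ₗ-cong e as)

  module Expansion {a} {A : Set a} (π : Carrier) (α β : A → Carrier) where

    -- `Z₁` and `Z₂` are the coefficients of π and π² in the product of the `α a + π * β a`. `Z₃`
    -- collects all higher orders at once, hence the full factor `α a + π * β a` in its recursion;
    -- this makes `expansion` an identity rather than a congruence.
    Z₁ Z₂ Z₃ : List A → Carrier
    Z₁ []       = 0#
    Z₁ (a ∷ as) = β a * ∏ₗ α as + α a * Z₁ as
    Z₂ []       = 0#
    Z₂ (a ∷ as) = β a * Z₁ as + α a * Z₂ as
    Z₃ []       = 0#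
    Z₃ (a ∷ as) = β a * Z₂ as + (α a + π * β a) * Z₃ as

    expansion : ∀ as → ∏ₗ (λ a → α a + π * β a) as ≈
      ∏ₗ α as + (π * Z₁ as + (π * (π * Z₂ as) + π * (π * (π * Z₃ as))))
    expansion []       = ≈-sym (begin
      1# + (π * 0# + (π * (π * 0#) + π * (π * (π * 0#))))
        ≈⟨ +-congˡ (+-cong π0 (+-cong (≈-trans (*-congˡ π0) π0) (≈-trans (*-congˡ (≈-trans (*-congˡ π0) π0)) π0))) ⟩
      1# + (0# + (0# + 0#)) ≈⟨ +-congˡ (≈-trans (+-identityˡ _) (+-identityˡ _)) ⟩
      1# + 0#               ≈⟨ +-identityʳ 1# ⟩
      1#                    ∎)
      where
      π0 : π * 0# ≈ 0#
      π0 = zeroʳ π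
    expansion (a ∷ as) = begin
      (α a + π * β a) * ∏ₗ (λ a → α a + π * β a) as  ≈⟨ *-congˡ (expansion as) ⟩
      (α a + π * β a) * (∏ₗ α as + (π * Z₁ as + (π * (π * Z₂ as) + π * (π * (π * Z₃ as)))))
        ≈⟨ solve 7 (λ x y π p z₁ z₂ z₃ →
             (x :+ π :* y) :* (p :+ (π :* z₁ :+ (π :* (π :* z₂) :+ π :* (π :* (π :* z₃)))))
             := x :* p :+ (π :* (y :* p :+ x :* z₁) :+ (π :* (π :* (y :* z₁ :+ x :* z₂))
                 :+ π :* (π :* (π :* (y :* z₂ :+ (x :+ π :* y) :* z₃))))))
             ≈-refl (α a) (β a) π (∏ₗ α as) (Z₁ as) (Z₂ as) (Z₃ as) ⟩
      _ ∎

  module Frobenius {q : ℕ} (c : Fin q → ℕ) (c-spec : ∀ i → suc q C suc (toℕ i) ≡ suc q ℕ.* c i) where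

    private
      p : ℕ
      p = suc q

    -- The index `i` stands for the exponent k = i + 1 with 0 < k < p, so that the other exponent p
    -- - k is `q ∸ toℕ i`. The quotient C(p,k)/p is the given number `c i`, as a semiring has no
    -- division.
    middleTerm : Carrier → Carrier → Fin q → Carrier
    middleTerm x y i = c i × (x ^ suc (toℕ i) * y ^ (q ∸ toℕ i))

    middle : Carrier → Carrier → Carrier
    middle x y = ∑[ i < q ] middleTerm x y i

    ×-distrib-sum : ∀ {n} m (t : Fin n → Carrier) → sum (λ i → m × t i) ≈ m × sum t
    ×-distrib-sum {n} m t = begin
      sum (λ i → m × t i)            ≈⟨ sum-cong-≋ (λ i → ≈-trans (×-congʳ m (≈-sym (*-identityˡ (t i)))) (≈-sym (×-assoc-* m 1# (t i)))) ⟩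
      sum (λ i → (m × 1#) * t i)     ≈⟨ *-distribˡ-sum (m × 1#) t ⟨
      (m × 1#) * sum t               ≈⟨ ×-assoc-* m 1# (sum t) ⟩
      m × (1# * sum t)               ≈⟨ ×-congʳ m (*-identityˡ (sum t)) ⟩
      m × sum t                      ∎

    frobenius : ∀ x y → (x + y) ^ p ≈ x ^ p + y ^ p + p × middle x y
    frobenius x y = begin
      (x + y) ^ p                                   ≈⟨ theorem p x y ⟩
      t zero + sum (λ j → t (suc j))                ≈⟨ +-cong first (sum-init-last (λ j → t (suc j))) ⟩
      y ^ p + (sum (λ i → t (suc (Fin.inject₁ i))) + t (suc (Fin.fromℕ q)))
        ≈⟨ +-congˡ (+-cong (≈-trans (sum-cong-≋ inner) (×-distrib-sum p (middleTerm x y))) final) ⟩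
      y ^ p + (p × middle x y + x ^ p)
        ≈⟨ solve 3 (λ a b c → a :+ (b :+ c) := c :+ a :+ b) ≈-refl (y ^ p) (p × middle x y) (x ^ p) ⟩
      x ^ p + y ^ p + p × middle x y                ∎
      where
      t : Fin (suc p) → Carrier
      t = binomialTerm x y p
      first : t zero ≈ y ^ p
      first = ≈-trans (×-homo-1 _) (*-identityˡ _)
      inner : ∀ i → t (suc (Fin.inject₁ i)) ≈ p × middleTerm x y i
      inner i = begin
        t (suc (Fin.inject₁ i)) ≡⟨ ≡.cong (λ k → (p C suc k) × (x ^ suc k * y ^ (q ∸ k))) (Finₚ.toℕ-inject₁ i) ⟩
        (p C suc (toℕ i)) × (x ^ suc (toℕ i) * y ^ (q ∸ toℕ i)) ≈⟨ ×-congˡ (c-spec i) ⟩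
        (p ℕ.* c i) × (x ^ suc (toℕ i) * y ^ (q ∸ toℕ i))       ≈⟨ ×-assocˡ _ p (c i) ⟨
        p × middleTerm x y i ∎
      final : t (suc (Fin.fromℕ q)) ≈ x ^ p
      final = begin
        t (suc (Fin.fromℕ q))            ≡⟨ ≡.cong (λ k → (p C suc k) × (x ^ suc k * y ^ (q ∸ k))) (Finₚ.toℕ-fromℕ q) ⟩
        (p C p) × (x ^ p * y ^ (q ∸ q))  ≡⟨ ≡.cong₂ (λ k l → k × (x ^ p * y ^ l)) (nCn≡1 p) (ℕ.n∸n≡0 q) ⟩
        1 × (x ^ p * 1#)                 ≈⟨ ×-homo-1 _ ⟩
        x ^ p * 1#                       ≈⟨ *-identityʳ _ ⟩
        x ^ p                            ∎

    -- Peeling off one summand at a time replaces multinomial coefficients by binomial ones. Each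
    -- `middle` contains its own letter with an exponent strictly between 0 and p, next to a sum of
    -- later letters only; all vanishing arguments below rest on this shape.
    remainder : ∀ {a} {A : Set a} → (A → Carrier) → List A → Carrier
    remainder x []       = 0#
    remainder x (a ∷ as) = middle (x a) (∑ₗ x as) + remainder x as

    frobenius-∑ₗ : ∀ {a} {A : Set a} (x : A → Carrier) as →
      ∑ₗ x as ^ p ≈ ∑ₗ (λ a → x a ^ p) as + p × remainder x as
    frobenius-∑ₗ x []       = ≈-trans (zeroˡ _) (≈-sym (≈-trans (+-identityˡ _) (p×0 p)))
      where
      p×0 : ∀ n → n × 0# ≈ 0#
      p×0 zero    = ≈-refl
      p×0 (suc n) = ≈-trans (+-identityˡ _) (p×0 n)
    frobenius-∑ₗ x (a ∷ as) = begin
      (x a + ∑ₗ x as) ^ p                                   ≈⟨ frobenius (x a) (∑ₗ x as) ⟩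
      x a ^ p + ∑ₗ x as ^ p + p × middle (x a) (∑ₗ x as)    ≈⟨ +-congʳ (+-congˡ (frobenius-∑ₗ x as)) ⟩
      x a ^ p + (Y + p × remainder x as) + p × middle (x a) (∑ₗ x as)
        ≈⟨ solve 4 (λ a b c d → a :+ (b :+ c) :+ d := a :+ b :+ (d :+ c)) ≈-refl (x a ^ p) Y (p × remainder x as) (p × middle (x a) (∑ₗ x as)) ⟩
      x a ^ p + Y + (p × middle (x a) (∑ₗ x as) + p × remainder x as) ≈⟨ +-congˡ (×-distrib-+ _ _ p) ⟨
      x a ^ p + Y + p × remainder x (a ∷ as)                ∎
      where
      Y = ∑ₗ (λ a → x a ^ p) as
      open import Algebra.Properties.CommutativeMonoid.Mult +-commutativeMonoid using (×-distrib-+)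

-- Polynomials with natural coefficients as formal sums.

open import Relation.Binary.PropositionalEquality hiding ([_])
open import Data.Nat using (_+_; _*_; _!; _<_; s≤s; z≤n)
open import Data.Nat.Divisibility using (divides; quotient; m%n≡0⇒n∣m; ∣⇒≤; ∣-refl; ∣-trans; ∣m⇒∣m*n; *-monoˡ-∣; ∣m∣n⇒∣m+n; ∣m+n∣m⇒∣n) renaming (_∣_ to _∣ℕ_)

-- Polynomials with coefficients in ℕ: a list of monomials, compared through all linear functionals.
module FormalSums {M : Set} {_∙_ : Op₂ M} {ε : M} (isCM : IsCommutativeMonoid _≡_ _∙_ ε) where

  private module M = IsCommutativeMonoid isCM
  open ≡-Reasoning

  infixl 6 _⊕_
  infixl 7 _⊗_

  opaque
    ⟨_,_⟩ : List M → (M → ℕ) → ℕ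
    ⟨ []    , f ⟩ = 0
    ⟨ m ∷ P , f ⟩ = f m + ⟨ P , f ⟩

    𝟘 : List M
    𝟘 = []

    monomial : M → List M
    monomial m = m ∷ []

    _⊕_ : List M → List M → List M
    _⊕_ = _++_

    _⊗_ : List M → List M → List M
    []      ⊗ Q = []
    (m ∷ P) ⊗ Q = map (m ∙_) Q ++ P ⊗ Q

    eval-𝟘 : ∀ f → ⟨ 𝟘 , f ⟩ ≡ 0
    eval-𝟘 f = refl

    eval-monomial : ∀ m f → ⟨ monomial m , f ⟩ ≡ f m
    eval-monomial m f = ℕ.+-identityʳ (f m)

    eval-⊕ : ∀ P Q f → ⟨ P ⊕ Q , f ⟩ ≡ ⟨ P , f ⟩ + ⟨ Q , f ⟩
    eval-⊕ []      Q f = refl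
    eval-⊕ (m ∷ P) Q f = trans (cong (f m +_) (eval-⊕ P Q f)) (sym (ℕ.+-assoc (f m) _ _))

    -- A functional on a product is an iterated functional, so the laws of `⊗` become laws of nested
    -- sums in ℕ; commutativity, for instance, is an exchange of summations.
    eval-⊗ : ∀ P Q f → ⟨ P ⊗ Q , f ⟩ ≡ ⟨ P , (λ m → ⟨ Q , (λ k → f (m ∙ k)) ⟩) ⟩
    eval-⊗ []      Q f = refl
    eval-⊗ (m ∷ P) Q f = trans (eval-⊕ (map (m ∙_) Q) (P ⊗ Q) f) (cong₂ _+_ (eval-map Q) (eval-⊗ P Q f))
      where
      eval-map : ∀ Q → ⟨ map (m ∙_) Q , f ⟩ ≡ ⟨ Q , (λ k → f (m ∙ k)) ⟩
      eval-map []      = refl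
      eval-map (k ∷ Q) = cong (f (m ∙ k) +_) (eval-map Q)

    eval-cong : ∀ P {f g} → (∀ m → f m ≡ g m) → ⟨ P , f ⟩ ≡ ⟨ P , g ⟩
    eval-cong []      e = refl
    eval-cong (m ∷ P) e = cong₂ _+_ (e m) (eval-cong P e)

    eval-0 : ∀ P → ⟨ P , (λ _ → 0) ⟩ ≡ 0
    eval-0 []      = refl
    eval-0 (m ∷ P) = eval-0 P

    eval-+ : ∀ P f g → ⟨ P , (λ m → f m + g m) ⟩ ≡ ⟨ P , f ⟩ + ⟨ P , g ⟩
    eval-+ []      f g = refl
    eval-+ (m ∷ P) f g = trans (cong (f m + g m +_) (eval-+ P f g)) (shuffle (f m) (g m) ⟨ P , f ⟩ ⟨ P , g ⟩)
      where
      shuffle : ∀ a b c d → a + b + (c + d) ≡ a + c + (b + d)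
      shuffle = solve-∀

    eval-swap : ∀ P Q (f : M → M → ℕ) →
      ⟨ P , (λ m → ⟨ Q , f m ⟩) ⟩ ≡ ⟨ Q , (λ k → ⟨ P , (λ m → f m k) ⟩) ⟩
    eval-swap []      Q f = sym (eval-0 Q)
    eval-swap (m ∷ P) Q f = trans (cong (⟨ Q , f m ⟩ +_) (eval-swap P Q f)) (sym (eval-+ Q (f m) _))

  infix 4 _≈_
  record _≈_ (P Q : List M) : Set where
    constructor mk≈
    field at : ∀ f → ⟨ P , f ⟩ ≡ ⟨ Q , f ⟩
  open _≈_ public

  private
    ≈-isEquivalence : IsEquivalence _≈_
    ≈-isEquivalence = record
      { refl  = mk≈ λ f → refl
      ; sym   = λ e → mk≈ λ f → sym (at e f)
      ; trans = λ e e′ → mk≈ λ f → trans (at e f) (at e′ f)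
      }

    ⊗-comm : ∀ P Q → P ⊗ Q ≈ Q ⊗ P
    ⊗-comm P Q = mk≈ λ f → begin
      ⟨ P ⊗ Q , f ⟩                             ≡⟨ eval-⊗ P Q f ⟩
      ⟨ P , (λ m → ⟨ Q , (λ k → f (m ∙ k)) ⟩) ⟩ ≡⟨ eval-swap P Q _ ⟩
      ⟨ Q , (λ k → ⟨ P , (λ m → f (m ∙ k)) ⟩) ⟩ ≡⟨ eval-cong Q (λ k → eval-cong P (λ m → cong f (M.comm m k))) ⟩
      ⟨ Q , (λ k → ⟨ P , (λ m → f (k ∙ m)) ⟩) ⟩ ≡⟨ eval-⊗ Q P f ⟨
      ⟨ Q ⊗ P , f ⟩                             ∎

    ⊗-congˡ : ∀ P {Q Q′} → Q ≈ Q′ → P ⊗ Q ≈ P ⊗ Q′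
    ⊗-congˡ P {Q} {Q′} e = mk≈ λ f →
      trans (eval-⊗ P Q f) (trans (eval-cong P (λ m → at e _)) (sym (eval-⊗ P Q′ f)))

    ⊗-cong : ∀ {P P′ Q Q′} → P ≈ P′ → Q ≈ Q′ → P ⊗ Q ≈ P′ ⊗ Q′
    ⊗-cong {P} {P′} {Q} {Q′} e e′ = mk≈ λ f →
      trans (at (⊗-congˡ P e′) f) (trans (at (⊗-comm P Q′) f) (trans (at (⊗-congˡ Q′ e) f) (at (⊗-comm Q′ P′) f)))

    ⊗-assoc : ∀ P Q R → (P ⊗ Q) ⊗ R ≈ P ⊗ (Q ⊗ R)
    ⊗-assoc P Q R = mk≈ λ f → begin
      ⟨ P ⊗ Q ⊗ R , f ⟩   ≡⟨ eval-⊗ (P ⊗ Q) R f ⟩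
      ⟨ P ⊗ Q , (λ u → ⟨ R , (λ r → f (u ∙ r)) ⟩) ⟩  ≡⟨ eval-⊗ P Q _ ⟩
      ⟨ P , (λ m → ⟨ Q , (λ k → ⟨ R , (λ r → f ((m ∙ k) ∙ r)) ⟩) ⟩) ⟩
        ≡⟨ eval-cong P (λ m → eval-cong Q (λ k → eval-cong R (λ r → cong f (M.assoc m k r)))) ⟩
      ⟨ P , (λ m → ⟨ Q , (λ k → ⟨ R , (λ r → f (m ∙ (k ∙ r))) ⟩) ⟩) ⟩ ≡⟨ eval-cong P (λ m → eval-⊗ Q R _) ⟨
      ⟨ P , (λ m → ⟨ Q ⊗ R , (λ u → f (m ∙ u)) ⟩) ⟩  ≡⟨ eval-⊗ P (Q ⊗ R) f ⟨
      ⟨ P ⊗ (Q ⊗ R) , f ⟩ ∎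

    ⊗-identityˡ : ∀ P → monomial ε ⊗ P ≈ P
    ⊗-identityˡ P = mk≈ λ f → trans (eval-⊗ (monomial ε) P f)
      (trans (eval-monomial ε _) (eval-cong P (λ m → cong f (M.identityˡ m))))

    ⊕-identityˡ : ∀ P → 𝟘 ⊕ P ≈ P
    ⊕-identityˡ P = mk≈ λ f → trans (eval-⊕ 𝟘 P f) (cong (_+ ⟨ P , f ⟩) (eval-𝟘 f))

    ⊕-comm : ∀ P Q → P ⊕ Q ≈ Q ⊕ P
    ⊕-comm P Q = mk≈ λ f → trans (eval-⊕ P Q f) (trans (ℕ.+-comm ⟨ P , f ⟩ _) (sym (eval-⊕ Q P f)))

    ⊕-cong : ∀ {P P′ Q Q′} → P ≈ P′ → Q ≈ Q′ → P ⊕ Q ≈ P′ ⊕ Q′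
    ⊕-cong {P} {P′} {Q} {Q′} e e′ = mk≈ λ f →
      trans (eval-⊕ P Q f) (trans (cong₂ _+_ (at e f) (at e′ f)) (sym (eval-⊕ P′ Q′ f)))

    ⊕-assoc : ∀ P Q R → (P ⊕ Q) ⊕ R ≈ P ⊕ (Q ⊕ R)
    ⊕-assoc P Q R = mk≈ λ f → begin
      ⟨ (P ⊕ Q) ⊕ R , f ⟩               ≡⟨ eval-⊕ (P ⊕ Q) R f ⟩
      ⟨ P ⊕ Q , f ⟩ + ⟨ R , f ⟩          ≡⟨ cong (_+ ⟨ R , f ⟩) (eval-⊕ P Q f) ⟩
      ⟨ P , f ⟩ + ⟨ Q , f ⟩ + ⟨ R , f ⟩   ≡⟨ ℕ.+-assoc ⟨ P , f ⟩ _ _ ⟩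
      ⟨ P , f ⟩ + (⟨ Q , f ⟩ + ⟨ R , f ⟩) ≡⟨ cong (⟨ P , f ⟩ +_) (eval-⊕ Q R f) ⟨
      ⟨ P , f ⟩ + ⟨ Q ⊕ R , f ⟩          ≡⟨ eval-⊕ P (Q ⊕ R) f ⟨
      ⟨ P ⊕ (Q ⊕ R) , f ⟩               ∎

    ⊗-distribʳ : ∀ R P Q → (P ⊕ Q) ⊗ R ≈ P ⊗ R ⊕ Q ⊗ R
    ⊗-distribʳ R P Q = mk≈ λ f → begin
      ⟨ (P ⊕ Q) ⊗ R , f ⟩             ≡⟨ eval-⊗ (P ⊕ Q) R f ⟩
      ⟨ P ⊕ Q , _ ⟩                   ≡⟨ eval-⊕ P Q _ ⟩
      ⟨ P , _ ⟩ + ⟨ Q , _ ⟩            ≡⟨ cong₂ _+_ (eval-⊗ P R f) (eval-⊗ Q R f) ⟨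
      ⟨ P ⊗ R , f ⟩ + ⟨ Q ⊗ R , f ⟩    ≡⟨ eval-⊕ (P ⊗ R) (Q ⊗ R) f ⟨
      ⟨ P ⊗ R ⊕ Q ⊗ R , f ⟩           ∎

    ⊕-isCommutativeMonoid : IsCommutativeMonoid _≈_ _⊕_ 𝟘
    ⊕-isCommutativeMonoid = record
      { isMonoid = record
        { isSemigroup = record
          { isMagma = record { isEquivalence = ≈-isEquivalence ; ∙-cong = ⊕-cong }
          ; assoc   = ⊕-assoc
          }
        ; identity = ⊕-identityˡ , (λ P → IsEquivalence.trans ≈-isEquivalence (⊕-comm P 𝟘) (⊕-identityˡ P))
        }
      ; comm = ⊕-comm
      }

    ⊗-isCommutativeMonoid : IsCommutativeMonoid _≈_ _⊗_ (monomial ε)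
    ⊗-isCommutativeMonoid = record
      { isMonoid = record
        { isSemigroup = record
          { isMagma = record { isEquivalence = ≈-isEquivalence ; ∙-cong = ⊗-cong }
          ; assoc   = ⊗-assoc
          }
        ; identity = ⊗-identityˡ , λ P → IsEquivalence.trans ≈-isEquivalence (⊗-comm P (monomial ε)) (⊗-identityˡ P)
        }
      ; comm = ⊗-comm
      }

  semiring : CommutativeSemiring 0ℓ 0ℓ
  semiring = record
    { Carrier = List M
    ; _≈_     = _≈_
    ; _+_     = _⊕_
    ; _*_     = _⊗_
    ; 0#      = 𝟘
    ; 1#      = monomial ε
    ; isCommutativeSemiring = isCommutativeSemiringˡ record
      { +-isCommutativeMonoid = ⊕-isCommutativeMonoid
      ; *-isCommutativeMonoid = ⊗-isCommutativeMonoid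
      ; distribʳ              = ⊗-distribʳ
      ; zeroˡ                 = λ P → mk≈ λ f → trans (eval-⊗ 𝟘 P f) (trans (eval-𝟘 _) (sym (eval-𝟘 f)))
      }
    }

-- Binomial coefficients modulo p and the divisibility of 6w.

module NumberTheory where
  open ≡-Reasoning
  open ℕSum

  absorption : ∀ n k → suc k * (suc n C suc k) ≡ suc n * (n C k)
  absorption zero    zero    = refl
  absorption zero    (suc k) = trans (cong (suc (suc k) *_) (k>n⇒nCk≡0 {1} {2 + k} (s≤s (s≤s z≤n)))) (ℕ.*-zeroʳ k)
  absorption (suc n) zero    = trans (ℕ.*-identityˡ (suc (suc n) C 1)) (trans (nC1≡n (2 + n)) (sym (ℕ.*-identityʳ (2 + n))))
  absorption (suc n) (suc k) = begin
    (2 + k) * ((2 + n) C (2 + k))              ≡⟨ cong ((2 + k) *_) (nCk+nC[k+1]≡[n+1]C[k+1] (suc n) (suc k)) ⟨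
    (2 + k) * (a + b)                      ≡⟨ split k a b ⟩
    suc k * a + a + (2 + k) * b            ≡⟨ cong₂ (λ u v → u + a + v) (absorption n k) (absorption n (suc k)) ⟩
    suc n * (n C k) + a + suc n * (n C suc k)  ≡⟨ merge n a (n C k) (n C suc k) ⟩
    suc n * (n C k + n C suc k) + a        ≡⟨ cong (λ u → suc n * u + a) (nCk+nC[k+1]≡[n+1]C[k+1] n k) ⟩
    suc n * a + a                          ≡⟨ ℕ.+-comm (suc n * a) a ⟩
    (2 + n) * a                            ∎
    where
    a = suc n C suc k
    b = suc n C (2 + k)
    split : ∀ k a b → (2 + k) * (a + b) ≡ suc k * a + a + (2 + k) * b
    split = solve-∀
    merge : ∀ n a c d → suc n * c + a + suc n * d ≡ suc n * (c + d) + a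
    merge = solve-∀

  -- Absorption makes (k+1) C(p,k+1) a multiple of p, and p cannot divide the smaller positive
  -- number k+1.
  prime∣binomial : ∀ {q k} → Prime (suc q) → k < q → suc q ∣ℕ (suc q C suc k)
  prime∣binomial {q} {k} pr k<q with euclidsLemma (suc k) (suc q C suc k) pr
    (divides (q C k) (trans (absorption q k) (ℕ.*-comm (suc q) (q C k))))
  ... | inj₁ p∣k = contradiction (∣⇒≤ p∣k) (ℕ.<⇒≱ (s≤s k<q))
  ... | inj₂ p∣C = p∣C

  6∑k² : ∀ q → 6 * ∑[ i < q ] (suc (toℕ i) * suc (toℕ i)) ≡ q * suc q * suc (2 * q)
  6∑k² zero = refl
  6∑k² (suc q) = begin
    6 * sum f                         ≡⟨ cong (6 *_) (sum-init-last f) ⟩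
    6 * (sum (λ i → f (Fin.inject₁ i)) + f (Fin.fromℕ q)) ≡⟨ cong (6 *_) (cong₂ _+_ (sum-cong-≗ {q} λ i → cong (λ k → suc k * suc k) (Finₚ.toℕ-inject₁ i)) (cong (λ k → suc k * suc k) (Finₚ.toℕ-fromℕ q))) ⟩
    6 * (∑[ i < q ] (suc (toℕ i) * suc (toℕ i)) + suc q * suc q) ≡⟨ ℕ.*-distribˡ-+ 6 (∑[ i < q ] (suc (toℕ i) * suc (toℕ i))) _ ⟩
    6 * ∑[ i < q ] (suc (toℕ i) * suc (toℕ i)) + 6 * (suc q * suc q) ≡⟨ cong (_+ 6 * (suc q * suc q)) (6∑k² q) ⟩
    q * suc q * suc (2 * q) + 6 * (suc q * suc q) ≡⟨ step q ⟩
    suc q * suc (suc q) * suc (2 * suc q) ∎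
    where
    f : Fin (suc q) → ℕ
    f i = suc (toℕ i) * suc (toℕ i)
    step : ∀ q → q * suc q * suc (2 * q) + 6 * (suc q * suc q) ≡ suc q * suc (suc q) * suc (2 * suc q)
    step = solve-∀

  module Congruence (p : ℕ) .{{_ : NonZero p}} where
    infix 4 _≡ₚ_
    _≡ₚ_ : ℕ → ℕ → Set
    a ≡ₚ b = a % p ≡ b % p

    +-congₚ : ∀ {a b c d} → a ≡ₚ b → c ≡ₚ d → a + c ≡ₚ b + d
    +-congₚ {a} {b} {c} {d} e f = trans (%-distribˡ-+ a c p) (trans (cong₂ (λ u v → (u + v) % p) e f) (sym (%-distribˡ-+ b d p)))

    *-congₚ : ∀ {a b c d} → a ≡ₚ b → c ≡ₚ d → a * c ≡ₚ b * d
    *-congₚ {a} {b} {c} {d} e f = trans (%-distribˡ-* a c p) (trans (cong₂ (λ u v → (u * v) % p) e f) (sym (%-distribˡ-* b d p)))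

    sum-congₚ : ∀ {n} {f g : Fin n → ℕ} → (∀ i → f i ≡ₚ g i) → sum f ≡ₚ sum g
    sum-congₚ {zero}  e = refl
    sum-congₚ {suc n} {f} {g} e = +-congₚ {f zero} {g zero} (e zero) (sum-congₚ (λ i → e (suc i)))

    inverse-unique : ∀ {a b c} → b * a ≡ₚ 1 → b * c ≡ₚ 1 → a ≡ₚ c
    inverse-unique {a} {b} {c} ba bc = begin
      a % p             ≡⟨ cong (_% p) (ℕ.*-identityˡ a) ⟨
      (1 * a) % p       ≡⟨ *-congₚ {b * c} {1} {a} bc refl ⟨
      (b * c * a) % p   ≡⟨ cong (_% p) (exchange a b c) ⟩
      (b * a * c) % p   ≡⟨ *-congₚ {b * a} {1} {c} ba refl ⟩
      (1 * c) % p       ≡⟨ cong (_% p) (ℕ.*-identityˡ c) ⟩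
      c % p             ∎
      where
      exchange : ∀ a b c → b * c * a ≡ b * a * c
      exchange = solve-∀

    -- Reducing `e` modulo p gives a map `ι` on the nonzero residues, shifted down by one to fit
    -- `Fin q`. Uniqueness of inverses makes it an involution, so it merely permutes the squares
    -- being summed.
    ∑-inverse² : ∀ {q} → p ≡ suc q → (e : Fin q → ℕ) → (∀ i → suc (toℕ i) * e i ≡ₚ 1) →
      ∑[ i < q ] (e i * e i) ≡ₚ ∑[ i < q ] (suc (toℕ i) * suc (toℕ i))
    ∑-inverse² {q} refl e inv = trans (sum-congₚ e²≡) (cong (_% p) (sym (∑-permute square π)))
      where
      square : Fin q → ℕ
      square i = suc (toℕ i) * suc (toℕ i)

      -- An element of `Fin q` rules out p = 1, for which 1 % p would be 0.
      1≢0 : Fin q → 1 % p ≢ 0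
      1≢0 zero    ()
      1≢0 (suc _) ()

      nonzero : ∀ i → NonZero (e i % p)
      nonzero i = ≢-nonZero λ e≡0 → 1≢0 i (trans (sym (inv i))
        (trans (*-congₚ {suc (toℕ i)} {suc (toℕ i)} {e i} {0} refl e≡0) (cong (_% p) (ℕ.*-zeroʳ (toℕ i)))))

      ι< : ∀ i → pred (e i % p) < q
      ι< i = ℕ.≤-pred (subst (_< p) (sym (ℕ.suc-pred (e i % p) {{nonzero i}})) (m%n<n (e i) p))

      ι : Fin q → Fin q
      ι i = Fin.fromℕ< (ι< i)

      suc-ι : ∀ i → suc (toℕ (ι i)) ≡ e i % p
      suc-ι i = trans (cong suc (Finₚ.toℕ-fromℕ< (ι< i))) (ℕ.suc-pred (e i % p) {{nonzero i}})

      ι≡e : ∀ i → suc (toℕ (ι i)) ≡ₚ e i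
      ι≡e i = trans (cong (_% p) (suc-ι i)) (m%n%n≡m%n (e i) p)

      ι-involutive : ∀ i → ι (ι i) ≡ i
      ι-involutive i = Finₚ.toℕ-injective (ℕ.suc-injective (begin
        suc (toℕ (ι (ι i)))  ≡⟨ suc-ι (ι i) ⟩
        e (ι i) % p          ≡⟨ inverse-unique {e (ι i)} {b} {suc (toℕ i)} (inv (ι i)) b*i≡1 ⟩
        suc (toℕ i) % p      ≡⟨ m<n⇒m%n≡m (s≤s (Finₚ.toℕ<n i)) ⟩
        suc (toℕ i)          ∎))
        where
        b = suc (toℕ (ι i))
        b*i≡1 : b * suc (toℕ i) ≡ₚ 1
        b*i≡1 = trans (*-congₚ {b} {e i} {suc (toℕ i)} (ι≡e i) refl)
                  (trans (cong (_% p) (ℕ.*-comm (e i) (suc (toℕ i)))) (inv i))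

      π : Permutation q q
      π = permutation ι ι (λ i → ι-involutive i) (λ i → ι-involutive i)

      e²≡ : ∀ i → e i * e i ≡ₚ square (ι i)
      e²≡ i = *-congₚ {e i} {suc (toℕ (ι i))} {e i} {suc (toℕ (ι i))} (sym (ι≡e i)) (sym (ι≡e i))

  module PrimeBinomials {q : ℕ} (pr : Prime (suc q)) where
    p : ℕ
    p = suc q

    open Congruence p

    c : Fin q → ℕ
    c i = quotient (prime∣binomial pr (Finₚ.toℕ<n i))

    c-spec : ∀ i → p C suc (toℕ i) ≡ p * c i
    c-spec i = trans (_∣ℕ_.equality (prime∣binomial pr (Finₚ.toℕ<n i))) (ℕ.*-comm (c i) p)

    -- The form in which the constant arises when two middle terms are multiplied: exponent k of a
    -- letter is completed to p by exponent p - k. The symmetry of binomial coefficients turns it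
    -- into Σ c_k².
    w : ℕ
    w = ∑[ i < q ] (c i * c (opposite i))

    private
      c-opposite : ∀ i → c (opposite i) ≡ c i
      c-opposite i = ℕ.*-cancelˡ-≡ _ _ p (begin
        p * c (opposite i)           ≡⟨ c-spec (opposite i) ⟨
        p C suc (toℕ (opposite i))   ≡⟨ cong (λ k → p C k) (trans (cong suc (Finₚ.opposite-prop i)) (sym (ℕ.+-∸-assoc 1 (Finₚ.toℕ<n i)))) ⟩
        p C (p ∸ suc (toℕ i))        ≡⟨ nCk≡nC[n∸k] {suc (toℕ i)} {p} (s≤s (ℕ.<⇒≤ (Finₚ.toℕ<n i))) ⟨
        p C suc (toℕ i)              ≡⟨ c-spec i ⟩
        p * c i                      ∎)

      -- Absorption with p cancelled. The right side is ±1 modulo p, so this is the source of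
      -- C(p,k)/p ≡ ±1/k; only its square is used, and the sign is never tracked.
      k*c : ∀ i → suc (toℕ i) * c i ≡ q C toℕ i
      k*c i = ℕ.*-cancelˡ-≡ _ _ p (begin
        p * (k * c i)   ≡⟨ exchange p k (c i) ⟩
        k * (p * c i)   ≡⟨ cong (k *_) (c-spec i) ⟨
        k * (p C k)     ≡⟨ absorption q (toℕ i) ⟩
        p * (q C toℕ i) ∎)
        where
        k = suc (toℕ i)
        exchange : ∀ a b c → a * (b * c) ≡ b * (a * c)
        exchange = solve-∀

      q²≡1 : 0 < q → q * q ≡ₚ 1
      q²≡1 (s≤s {n = r} z≤n) = trans (cong (_% p) (expand r)) ([m+kn]%n≡m%n 1 r p)
        where
        expand : ∀ r → suc r * suc r ≡ 1 + r * (2 + r)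
        expand = solve-∀

      -- Pascal's rule and p ∣ C(p,k+1) give C(q,k+1) ≡ -C(q,k) ≡ q C(q,k).
      binomial²≡1 : ∀ k → k < q → (q C k) * (q C k) ≡ₚ 1
      binomial²≡1 zero    0<q = refl
      binomial²≡1 (suc k) k<q = begin
        (b * b) % p                 ≡⟨ *-congₚ {b} {q * a} {b} b≡qa b≡qa ⟩
        (q * a * (q * a)) % p       ≡⟨ cong (_% p) (exchange q a) ⟩
        (q * q * (a * a)) % p       ≡⟨ *-congₚ {q * q} {1} {a * a} {1} (q²≡1 (ℕ.≤-<-trans z≤n k<q)) (binomial²≡1 k (ℕ.<⇒≤ k<q)) ⟩
        (1 * 1) % p                 ∎
        where
        a = q C k
        b = q C suc k
        exchange : ∀ q a → q * a * (q * a) ≡ q * q * (a * a)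
        exchange = solve-∀
        regroup : ∀ a b q → b + a * suc q ≡ q * a + (a + b)
        regroup = solve-∀
        b≡qa : b ≡ₚ q * a
        b≡qa = begin
          b % p                  ≡⟨ [m+kn]%n≡m%n b a p ⟨
          (b + a * p) % p        ≡⟨ cong (_% p) (regroup a b q) ⟩
          (q * a + (a + b)) % p  ≡⟨ %-remove-+ʳ (q * a) (subst (p ∣ℕ_) (sym (nCk+nC[k+1]≡[n+1]C[k+1] q k)) (prime∣binomial pr (ℕ.<⇒≤ k<q))) ⟩
          (q * a) % p            ∎

    -- k ↦ c_k² k is inversion modulo p, so w = Σ c_k² is congruent to Σ k².
    p∣6w : p ∣ℕ 6 * w
    p∣6w = m%n≡0⇒n∣m (6 * w) p (begin
      (6 * w) % p     ≡⟨ *-congₚ {6} {6} {w} {∑[ i < q ] (suc (toℕ i) * suc (toℕ i))} refl w≡∑k² ⟩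
      (6 * ∑[ i < q ] (suc (toℕ i) * suc (toℕ i))) % p ≡⟨ cong (_% p) (6∑k² q) ⟩
      (q * p * suc (2 * q)) % p  ≡⟨ cong (_% p) (pull q p (suc (2 * q))) ⟩
      (q * suc (2 * q) * p) % p  ≡⟨ m*n%n≡0 (q * suc (2 * q)) p ⟩
      0 ∎)
      where
      pull : ∀ a b d → a * b * d ≡ a * d * b
      pull = solve-∀
      e : Fin q → ℕ
      e i = c i * c i * suc (toℕ i)
      kc²≡1 : ∀ i → suc (toℕ i) * c i * (suc (toℕ i) * c i) ≡ₚ 1
      kc²≡1 i = trans (cong (λ u → (u * u) % p) (k*c i)) (binomial²≡1 (toℕ i) (Finₚ.toℕ<n i))
      e-inverse : ∀ i → suc (toℕ i) * e i ≡ₚ 1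
      e-inverse i = trans (cong (_% p) (regroup (suc (toℕ i)) (c i))) (kc²≡1 i)
        where
        regroup : ∀ k c → k * (c * c * k) ≡ k * c * (k * c)
        regroup = solve-∀
      cc≡e² : ∀ i → c i * c (opposite i) ≡ₚ e i * e i
      cc≡e² i = begin
        (c i * c (opposite i)) % p  ≡⟨ cong (λ u → (c i * u) % p) (c-opposite i) ⟩
        (c i * c i) % p             ≡⟨ cong (_% p) (ℕ.*-identityʳ (c i * c i)) ⟨
        (c i * c i * 1) % p         ≡⟨ *-congₚ {c i * c i} {c i * c i} {1} refl (sym (kc²≡1 i)) ⟩
        (c i * c i * (suc (toℕ i) * c i * (suc (toℕ i) * c i))) % p ≡⟨ cong (_% p) (regroup (suc (toℕ i)) (c i)) ⟩
        (e i * e i) % p             ∎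
        where
        regroup : ∀ k c → c * c * (k * c * (k * c)) ≡ c * c * k * (c * c * k)
        regroup = solve-∀
      w≡∑k² : w ≡ₚ ∑[ i < q ] (suc (toℕ i) * suc (toℕ i))
      w≡∑k² = trans (sum-congₚ cc≡e²) (∑-inverse² refl e e-inverse)

open NumberTheory

-- The alphabet, exponent vectors and coefficient extraction.

others : ∀ {n} → Fin n → List (Fin n)
others {n} b = filter (λ a → ¬? (a ≟ b)) (allFin n)

↭-unique : ∀ {n} {xs : List (Fin n)} → xs ↭ allFin n → Unique xs
↭-unique {n} e = Unique-resp-↭ (setoid (Fin n)) (↭⇒↭ₛ (↭-sym e)) (allFin⁺ n)

-- The alphabet may thus be listed in whatever order suits an argument: once `b` stands first, the
-- tail serves as its list of other letters.
others-↭ : ∀ {n} {b : Fin n} {xs} → b ∷ xs ↭ allFin n → others b ↭ xs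
others-↭ {n} {b} {xs} e with ↭-unique e
... | b∉xs ∷ _ = ↭-trans (filter-↭ P? (↭-sym e)) (↭-reflexive
  (trans (filter-reject P? (λ b≢b → b≢b refl)) (filter-all P? (All.map ≢-sym b∉xs))))
  where
  P? = λ a → ¬? (a ≟ b)

∷-others-↭ : ∀ {n} (b : Fin n) → b ∷ others b ↭ allFin n
∷-others-↭ {n} b with ∈-∃++ (∈-allFin b)
... | ys , zs , eq = ↭-trans (prep b (others-↭ e)) e
  where
  e : b ∷ ys ++ zs ↭ allFin n
  e = ↭-trans (↭-sym (shift b ys zs)) (↭-reflexive (sym eq))

module Polynomials (n : ℕ) where

  infixl 7 _∙_
  _∙_ : Vec ℕ n → Vec ℕ n → Vec ℕ n
  _∙_ = zipWith _+_

  ∙-isCommutativeMonoid : IsCommutativeMonoid _≡_ _∙_ (replicate n 0)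
  ∙-isCommutativeMonoid = record
    { isMonoid = record
      { isSemigroup = record
        { isMagma = record { isEquivalence = isEquivalence ; ∙-cong = cong₂ _∙_ }
        ; assoc   = Vecₚ.zipWith-assoc ℕ.+-assoc
        }
      ; identity = Vecₚ.zipWith-identityˡ ℕ.+-identityˡ , Vecₚ.zipWith-identityʳ ℕ.+-identityʳ
      }
    ; comm = Vecₚ.zipWith-comm ℕ.+-comm
    }

  open FormalSums ∙-isCommutativeMonoid public
  module R = CommutativeSemiring semiring
  open ListOperations semiring public

  Poly : Set
  Poly = List (Vec ℕ n)

  lookup-∙ : ∀ a m k → lookup (m ∙ k) a ≡ lookup m a + lookup k a
  lookup-∙ a = Vecₚ.lookup-zipWith _+_ a

  mono : ℕ → Fin n → Vec ℕ n
  mono t a = replicate n 0 [ a ]≔ t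

  lookup-mono : ∀ t a → lookup (mono t a) a ≡ t
  lookup-mono t a = Vecₚ.lookup∘update a (replicate n 0) t

  lookup-mono-≢ : ∀ t {a b} → b ≢ a → lookup (mono t a) b ≡ 0
  lookup-mono-≢ t {a} {b} b≢a = trans (Vecₚ.lookup∘update′ b≢a (replicate n 0) t) (Vecₚ.lookup-replicate b 0)

  var : ℕ → Fin n → Poly
  var t a = monomial (mono t a)

  eval-var-⊗ : ∀ t a P f → ⟨ var t a ⊗ P , f ⟩ ≡ ⟨ P , (λ m → f (mono t a ∙ m)) ⟩
  eval-var-⊗ t a P f = trans (eval-⊗ (var t a) P f) (eval-monomial (mono t a) _)

  eval-× : ∀ k P f → ⟨ k × P , f ⟩ ≡ k * ⟨ P , f ⟩
  eval-× zero    P f = eval-𝟘 f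
  eval-× (suc k) P f = trans (eval-⊕ P (k × P) f) (cong (⟨ P , f ⟩ +_) (eval-× k P f))

  opaque
    indicator : ℕ → Vec ℕ n → ℕ
    indicator t m = if all (λ a → ⌊ lookup m a ℕ.≟ t ⌋) (allFin n) then 1 else 0

    indicator-0 : ∀ t m a → lookup m a ≢ t → indicator t m ≡ 0
    indicator-0 t m a ≢t with all (λ a → ⌊ lookup m a ℕ.≟ t ⌋) (allFin n) in eq
    ... | false = refl
    ... | true  = contradiction
      (toWitness (All.lookup (Allₚ.all⁺ _ (allFin n) (subst T (sym eq) _)) (∈-allFin a))) ≢t

    indicator-1 : ∀ t m → (∀ a → lookup m a ≡ t) → indicator t m ≡ 1
    indicator-1 t m ≡t with all (λ a → ⌊ lookup m a ℕ.≟ t ⌋) (allFin n) in eq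
    ... | true  = refl
    ... | false = contradiction
      (subst T eq (Allₚ.all⁻ _ {xs = allFin n} (All.universal (λ a → fromWitness (≡t a)) (allFin n)))) (λ ())

  exponent : ℕ → List (Fin n) → Vec ℕ n
  exponent t []       = replicate n 0
  exponent t (a ∷ as) = mono t a ∙ exponent t as

  monomial-⊗ : ∀ m k → monomial m ⊗ monomial k ≈ monomial (m ∙ k)
  monomial-⊗ m k = mk≈ λ f → trans (eval-⊗ (monomial m) (monomial k) f)
    (trans (eval-monomial m _) (trans (eval-monomial k _) (sym (eval-monomial (m ∙ k) f))))

  ∏-var : ∀ t as → ∏ₗ (var t) as ≈ monomial (exponent t as)
  ∏-var t []       = R.refl
  ∏-var t (a ∷ as) = R.trans (R.*-congˡ (∏-var t as)) (monomial-⊗ (mono t a) (exponent t as))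

  exponent-↭ : ∀ t {as bs} → as ↭ bs → exponent t as ≡ exponent t bs
  exponent-↭ t _↭_.refl         = refl
  exponent-↭ t (_↭_.prep a e)   = cong (mono t a ∙_) (exponent-↭ t e)
  exponent-↭ t (_↭_.swap {as} {bs} a b e) = begin
    mono t a ∙ (mono t b ∙ exponent t as) ≡⟨ M.assoc (mono t a) (mono t b) _ ⟨
    mono t a ∙ mono t b ∙ exponent t as   ≡⟨ cong₂ _∙_ (M.comm (mono t a) (mono t b)) (exponent-↭ t e) ⟩
    mono t b ∙ mono t a ∙ exponent t bs   ≡⟨ M.assoc (mono t b) (mono t a) _ ⟩
    mono t b ∙ (mono t a ∙ exponent t bs) ∎
    where
    open ≡-Reasoning
    module M = IsCommutativeMonoid ∙-isCommutativeMonoid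
  exponent-↭ t (_↭_.trans e e′) = trans (exponent-↭ t e) (exponent-↭ t e′)

  lookup-exponent-∉ : ∀ t b {as} → All (_≢ b) as → lookup (exponent t as) b ≡ 0
  lookup-exponent-∉ t b []           = Vecₚ.lookup-replicate b 0
  lookup-exponent-∉ t b (_∷_ {x = a} {xs = as} a≢b p) = trans (lookup-∙ b (mono t a) (exponent t as))
    (cong₂ _+_ (lookup-mono-≢ t (≢-sym a≢b)) (lookup-exponent-∉ t b p))

  lookup-exponent-allFin : ∀ t b → lookup (exponent t (allFin n)) b ≡ t
  lookup-exponent-allFin t b = begin
    lookup (exponent t (allFin n)) b      ≡⟨ cong (λ m → lookup m b) (exponent-↭ t (∷-others-↭ b)) ⟨
    lookup (exponent t (b ∷ others b)) b  ≡⟨ lookup-∙ b (mono t b) (exponent t (others b)) ⟩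
    lookup (mono t b) b + lookup (exponent t (others b)) b
      ≡⟨ cong₂ _+_ (lookup-mono t b) (lookup-exponent-∉ t b (Allₚ.all-filter (λ a → ¬? (a ≟ b)) (allFin n))) ⟩
    t + 0                                 ≡⟨ ℕ.+-identityʳ t ⟩
    t                                     ∎
    where open ≡-Reasoning

  -- The coefficient of Π x_aᵗ, read off by pairing with its indicator.
  φ : ℕ → Poly → ℕ
  φ t P = ⟨ P , indicator t ⟩

  φ-cong : ∀ t {P Q} → P ≈ Q → φ t P ≡ φ t Q
  φ-cong t e = at e (indicator t)

  φ-⊕ : ∀ t P Q → φ t (P ⊕ Q) ≡ φ t P + φ t Q
  φ-⊕ t P Q = eval-⊕ P Q (indicator t)

-- The number of bijections between m + l positions and m + l letters when l of the positions forbid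
-- one letter each, all different; for these numbers the subtraction never truncates.
rencontres : ℕ → ℕ → ℕ
rencontres m zero    = m !
rencontres m (suc l) = rencontres (suc m) l ∸ rencontres m l

-- Coefficients of products of letters, full sums and sums omitting one letter.

module Values (n t : ℕ) .{{_ : NonZero t}} where
  open Polynomials n
  open import Algebra.Solver.Ring.NaturalCoefficients.Default semiring using (solve; _:=_; _:+_; _:*_)
  open ≡-Reasoning

  y A : Fin n → Poly
  y = var t
  A b = ∑ₗ y (others b)

  s : Poly
  s = ∑ₗ y (allFin n)

  s≈y+A : ∀ b → s ≈ y b ⊕ A b
  s≈y+A b = R.sym (∑ₗ-↭ y (∷-others-↭ b))

  φ-𝟘-⊗ : ∀ P → φ t (𝟘 ⊗ P) ≡ 0
  φ-𝟘-⊗ P = trans (φ-cong t (R.zeroˡ P)) (eval-𝟘 _)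

  -- A letter taken twice has exponent at least 2t, which exceeds t because t is nonzero.
  φ-square : ∀ a P → φ t (y a ⊗ (y a ⊗ P)) ≡ 0
  φ-square a P = trans (eval-var-⊗ t a _ _) (trans (eval-var-⊗ t a P _) (trans (eval-cong P vanish) (eval-0 P)))
    where
    vanish : ∀ m → indicator t (mono t a ∙ (mono t a ∙ m)) ≡ 0
    vanish m = indicator-0 t _ a λ eq → ℕ.<⇒≢ (ℕ.m<m+n t (ℕ.<-≤-trans (ℕ.>-nonZero⁻¹ t) (ℕ.m≤m+n t (lookup m a))))
      (sym (trans (sym lookup≡) eq))
      where
      lookup≡ : lookup (mono t a ∙ (mono t a ∙ m)) a ≡ t + (t + lookup m a)
      lookup≡ = trans (lookup-∙ a (mono t a) _) (cong₂ _+_ (lookup-mono t a)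
        (trans (lookup-∙ a (mono t a) m) (cong (_+ lookup m a) (lookup-mono t a))))

  φ-full : ∀ {K} → K ↭ allFin n → φ t (∏ₗ y K) ≡ 1
  φ-full {K} e = begin
    φ t (∏ₗ y K)                           ≡⟨ φ-cong t (∏-var t K) ⟩
    φ t (monomial (exponent t K))          ≡⟨ eval-monomial _ _ ⟩
    indicator t (exponent t K)             ≡⟨ cong (indicator t) (exponent-↭ t e) ⟩
    indicator t (exponent t (allFin n))    ≡⟨ indicator-1 t _ (lookup-exponent-allFin t) ⟩
    1                                      ∎

  -- Every letter of `bs` already occurs in the product over `K`, so `φ-square` kills each summand.
  -- The list `pre` retains the summands already split off, which lets `bs` shrink while `K` stays
  -- fixed; later inductions use the same device.
  φ-repeated : ∀ {K} W bs pre → pre ++ bs ↭ K → φ t (∑ₗ y bs ⊗ (∏ₗ y K ⊗ W)) ≡ 0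
  φ-repeated W []       pre e = φ-𝟘-⊗ _
  φ-repeated {K} W (b ∷ bs) pre e = begin
    φ t ((y b ⊕ ∑ₗ y bs) ⊗ P)                     ≡⟨ φ-cong t (R.distribʳ P (y b) (∑ₗ y bs)) ⟩
    φ t (y b ⊗ P ⊕ ∑ₗ y bs ⊗ P)                   ≡⟨ φ-⊕ t (y b ⊗ P) _ ⟩
    φ t (y b ⊗ P) + φ t (∑ₗ y bs ⊗ P)              ≡⟨ cong₂ _+_ first (φ-repeated W bs (b ∷ pre) e′) ⟩
    0                                              ∎
    where
    P = ∏ₗ y K ⊗ W
    e′ : b ∷ pre ++ bs ↭ K
    e′ = ↭-trans (↭-sym (shift b pre bs)) e
    first : φ t (y b ⊗ P) ≡ 0
    first = trans (φ-cong t (R.*-congˡ (R.trans (R.*-congʳ (R.sym (∏ₗ-↭ y e′))) (R.*-assoc (y b) _ W)))) (φ-square b _)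

  -- Open one factor `s`: its letters from `K` repeat and contribute nothing, while each letter of
  -- `F` moves into `K` and leaves one factor fewer. This is the recursion of the factorial.
  φ-power : ∀ m {K F} → length F ≡ m → K ++ F ↭ allFin n → φ t (∏ₗ y K ⊗ s ^ m) ≡ m !
  φ-power-∑ : ∀ m {K} bs pre → length (pre ++ bs) ≡ suc m → K ++ pre ++ bs ↭ allFin n →
    φ t (∑ₗ y bs ⊗ (∏ₗ y K ⊗ s ^ m)) ≡ length bs * m !

  φ-power zero    {K} {[]} _ e = trans (φ-cong t (R.*-identityʳ _)) (φ-full (↭-trans (↭-reflexive (sym (++-identityʳ K))) e))
  φ-power (suc m) {K} {F} |F| e = begin
    φ t (∏ₗ y K ⊗ (s ⊗ s ^ m))                     ≡⟨ φ-cong t split ⟩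
    φ t (∑ₗ y K ⊗ P ⊕ ∑ₗ y F ⊗ P)                 ≡⟨ φ-⊕ t (∑ₗ y K ⊗ P) _ ⟩
    φ t (∑ₗ y K ⊗ P) + φ t (∑ₗ y F ⊗ P)            ≡⟨ cong₂ _+_ (φ-repeated (s ^ m) K [] ↭-refl) (φ-power-∑ m F [] |F| e) ⟩
    length F * m !                                 ≡⟨ cong (_* m !) |F| ⟩
    suc m !                                        ∎
    where
    P = ∏ₗ y K ⊗ s ^ m
    split : ∏ₗ y K ⊗ (s ⊗ s ^ m) ≈ ∑ₗ y K ⊗ P ⊕ ∑ₗ y F ⊗ P
    split = R.trans (solve 3 (λ k s p → k :* (s :* p) := s :* (k :* p)) R.refl (∏ₗ y K) s (s ^ m))
      (R.trans (R.*-congʳ (R.trans (R.sym (∑ₗ-↭ y e)) (∑ₗ-++ y K F))) (R.distribʳ P (∑ₗ y K) (∑ₗ y F)))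

  φ-power-∑ m []       pre len e = φ-𝟘-⊗ _
  φ-power-∑ m {K} (b ∷ bs) pre len e = begin
    φ t ((y b ⊕ ∑ₗ y bs) ⊗ P)         ≡⟨ φ-cong t (R.distribʳ P (y b) (∑ₗ y bs)) ⟩
    φ t (y b ⊗ P ⊕ ∑ₗ y bs ⊗ P)       ≡⟨ φ-⊕ t (y b ⊗ P) _ ⟩
    φ t (y b ⊗ P) + φ t (∑ₗ y bs ⊗ P)  ≡⟨ cong₂ _+_ first rest ⟩
    m ! + length bs * m !              ∎
    where
    P = ∏ₗ y K ⊗ s ^ m
    moved : pre ++ b ∷ bs ↭ b ∷ pre ++ bs
    moved = shift b pre bs
    len′ : length (b ∷ pre ++ bs) ≡ suc m
    len′ = trans (sym (↭-length moved)) len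
    first : φ t (y b ⊗ P) ≡ m !
    first = trans (φ-cong t (R.sym (R.*-assoc (y b) (∏ₗ y K) (s ^ m))))
      (φ-power m {b ∷ K} {pre ++ bs} (ℕ.suc-injective len′)
        (↭-trans (↭-sym (shift b K (pre ++ bs))) (↭-trans (++⁺ˡ K (↭-sym moved)) e)))
    rest : φ t (∑ₗ y bs ⊗ P) ≡ length bs * m !
    rest = φ-power-∑ m {K} bs (b ∷ pre) len′ (↭-trans (++⁺ˡ K (↭-sym moved)) e)

  -- `K` holds the letters already used, `L` the rows that still forbid their own letter, `F` the
  -- letters forbidden in no row. Replacing `A b` by `s` moves `b` to `F`; the excess, where row `b`
  -- takes its own letter, moves `b` to `K`. The sum of the two coefficients is established first,
  -- so the truncated subtraction is exact. The result does not depend on t, so it serves both t = 1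
  -- and t = p.
  φ-value : ∀ L K F → K ++ L ++ F ↭ allFin n →
    φ t (∏ₗ y K ⊗ (s ^ length F ⊗ ∏ₗ A L)) ≡ rencontres (length F) (length L)
  φ-value []      K F e = trans (φ-cong t (R.*-congˡ (R.*-identityʳ _))) (φ-power (length F) {K} {F} refl e)
  φ-value (b ∷ L) K F e = begin
    φ t P                                    ≡⟨ ℕ.m+n∸n≡m (φ t P) (φ t P₂) ⟨
    φ t P + φ t P₂ ∸ φ t P₂                  ≡⟨ cong₂ _∸_ sum≡ (φ-value L (b ∷ K) F (↭-trans (↭-sym (shift b K (L ++ F))) e)) ⟩
    rencontres (suc (length F)) (length L) ∸ rencontres (length F) (length L) ∎
    where
    S = s ^ length F
    P = ∏ₗ y K ⊗ (S ⊗ ∏ₗ A (b ∷ L))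
    P₁ = ∏ₗ y K ⊗ ((s ⊗ S) ⊗ ∏ₗ A L)
    P₂ = ∏ₗ y (b ∷ K) ⊗ (S ⊗ ∏ₗ A L)
    combine : P ⊕ P₂ ≈ P₁
    combine = R.trans
      (solve 5 (λ k s a l y → (k :* (s :* (a :* l))) :+ ((y :* k) :* (s :* l)) := k :* (((y :+ a) :* s) :* l))
        R.refl (∏ₗ y K) S (A b) (∏ₗ A L) (y b))
      (R.*-congˡ (R.*-congʳ (R.*-congʳ (R.sym (s≈y+A b)))))
    sum≡ : φ t P + φ t P₂ ≡ rencontres (suc (length F)) (length L)
    sum≡ = begin
      φ t P + φ t P₂   ≡⟨ φ-⊕ t P P₂ ⟨
      φ t (P ⊕ P₂)    ≡⟨ φ-cong t combine ⟩
      φ t P₁           ≡⟨ φ-value L K (b ∷ F) (↭-trans (++⁺ˡ K (shift b L F)) e) ⟩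
      rencontres (suc (length F)) (length L) ∎

-- Counting words: P′ as a coefficient.

module NatList = ListOperations ℕ.+-*-commutativeSemiring
open NatList using () renaming (∑ₗ to ∑ℕ; ∑ₗ-++ to ∑ℕ-++)

∑ℕ-cong : ∀ {A : Set} {f g : A → ℕ} → (∀ a → f a ≡ g a) → ∀ as → ∑ℕ f as ≡ ∑ℕ g as
∑ℕ-cong e []       = refl
∑ℕ-cong e (a ∷ as) = cong₂ _+_ (e a) (∑ℕ-cong e as)

∑ℕ-0 : ∀ {A : Set} (as : List A) → ∑ℕ (λ _ → 0) as ≡ 0
∑ℕ-0 []       = refl
∑ℕ-0 (_ ∷ as) = ∑ℕ-0 as

∑ℕ-map : ∀ {A B : Set} (f : B → ℕ) (g : A → B) as → ∑ℕ f (map g as) ≡ ∑ℕ (λ a → f (g a)) as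
∑ℕ-map f g []       = refl
∑ℕ-map f g (a ∷ as) = cong (f (g a) +_) (∑ℕ-map f g as)

∑ℕ-concatMap : ∀ {A B : Set} (f : B → ℕ) (g : A → List B) as →
  ∑ℕ f (concatMap g as) ≡ ∑ℕ (λ a → ∑ℕ f (g a)) as
∑ℕ-concatMap f g []       = refl
∑ℕ-concatMap f g (a ∷ as) = trans (∑ℕ-++ f (g a) (concatMap g as)) (cong (∑ℕ f (g a) +_) (∑ℕ-concatMap f g as))

length-filter-T? : ∀ {A : Set} (p : A → Bool) as →
  length (filter (λ a → T? (p a)) as) ≡ ∑ℕ (λ a → if p a then 1 else 0) as
length-filter-T? p [] = refl
length-filter-T? p (a ∷ as) with p a
... | true  = cong suc (length-filter-T? p as)
... | false = length-filter-T? p as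

∑ℕ-filter-≢ : ∀ {n} (b : Fin n) (f : Fin n → ℕ) as →
  ∑ℕ f (filter (λ a → ¬? (a ≟ b)) as) ≡ ∑ℕ (λ a → if not ⌊ a ≟ b ⌋ then f a else 0) as
∑ℕ-filter-≢ b f [] = refl
∑ℕ-filter-≢ b f (a ∷ as) with a ≟ b
... | yes _ = ∑ℕ-filter-≢ b f as
... | no  _ = cong (f a +_) (∑ℕ-filter-≢ b f as)

module WordCount (n : ℕ) where
  open Polynomials n
  open ≡-Reasoning

  Q : Fin n → Poly
  Q b = ∑ₗ (var 1) (others b)

  eval-∑-var : ∀ t as f → ⟨ ∑ₗ (var t) as , f ⟩ ≡ ∑ℕ (λ a → f (mono t a)) as
  eval-∑-var t []       f = eval-𝟘 f
  eval-∑-var t (a ∷ as) f = trans (eval-⊕ (var t a) _ f) (cong₂ _+_ (eval-monomial (mono t a) f) (eval-∑-var t as f))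

  -- Expanding the product chooses at each position a letter different from that of `v`, that is, a
  -- word without fixed letters, whose monomial records its letter counts. The functional is
  -- arbitrary because the induction applies the claim to `f` shifted by the first letter.
  eval-∏Q : ∀ v f → ⟨ ∏ₗ Q v , f ⟩ ≡
    ∑ℕ (λ w → if noFixedLetter w v then f (exponent 1 w) else 0) (allWords n (length v))
  eval-∏Q []      f = trans (eval-monomial _ f) (sym (ℕ.+-identityʳ _))
  eval-∏Q (b ∷ v) f = begin
    ⟨ Q b ⊗ ∏ₗ Q v , f ⟩                                    ≡⟨ eval-⊗ (Q b) (∏ₗ Q v) f ⟩
    ⟨ Q b , (λ m → ⟨ ∏ₗ Q v , (λ k → f (m ∙ k)) ⟩) ⟩        ≡⟨ eval-∑-var 1 (others b) _ ⟩
    ∑ℕ (λ a → ⟨ ∏ₗ Q v , (λ k → f (mono 1 a ∙ k)) ⟩) (others b) ≡⟨ ∑ℕ-filter-≢ b _ (allFin n) ⟩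
    ∑ℕ (λ a → if not ⌊ a ≟ b ⌋ then ⟨ ∏ₗ Q v , (λ k → f (mono 1 a ∙ k)) ⟩ else 0) (allFin n)
      ≡⟨ ∑ℕ-cong letter (allFin n) ⟩
    ∑ℕ (λ a → ∑ℕ weight (map (a ∷_) (allWords n (length v)))) (allFin n)
      ≡⟨ ∑ℕ-concatMap weight _ (allFin n) ⟨
    ∑ℕ weight (allWords n (suc (length v)))                 ∎
    where
    weight : List (Fin n) → ℕ
    weight w = if noFixedLetter w (b ∷ v) then f (exponent 1 w) else 0
    letter : ∀ a → (if not ⌊ a ≟ b ⌋ then ⟨ ∏ₗ Q v , (λ k → f (mono 1 a ∙ k)) ⟩ else 0)
                 ≡ ∑ℕ weight (map (a ∷_) (allWords n (length v)))
    letter a = trans lemma (sym (∑ℕ-map weight (a ∷_) (allWords n (length v))))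
      where
      lemma : (if not ⌊ a ≟ b ⌋ then ⟨ ∏ₗ Q v , (λ k → f (mono 1 a ∙ k)) ⟩ else 0)
            ≡ ∑ℕ (λ w → weight (a ∷ w)) (allWords n (length v))
      lemma with a ≟ b
      ... | yes _ = sym (∑ℕ-0 (allWords n (length v)))
      ... | no  _ = eval-∏Q v (λ k → f (mono 1 a ∙ k))

  occ-exponent : ∀ a w → occ a w ≡ lookup (exponent 1 w) a
  occ-exponent a []      = sym (Vecₚ.lookup-replicate a 0)
  occ-exponent a (b ∷ w) with a ≟ b
  ... | yes refl = sym (trans (lookup-∙ a (mono 1 a) _) (cong₂ _+_ (lookup-mono 1 a) (sym (occ-exponent a w))))
  ... | no  a≢b  = sym (trans (lookup-∙ a (mono 1 b) _) (cong₂ _+_ (lookup-mono-≢ 1 a≢b) (sym (occ-exponent a w))))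

  occ-++ : ∀ (a : Fin n) v w → occ a (v ++ w) ≡ occ a v + occ a w
  occ-++ a []      w = refl
  occ-++ a (b ∷ v) w with a ≟ b
  ... | yes _ = cong suc (occ-++ a v w)
  ... | no  _ = occ-++ a v w

  occ-replicate : ∀ a t b → occ a (List.replicate t b) ≡ lookup (mono t b) a
  occ-replicate a t b with a ≟ b
  ... | yes refl = trans (same t) (sym (lookup-mono t a))
    where
    same : ∀ t → occ a (List.replicate t a) ≡ t
    same zero = refl
    same (suc t) with a ≟ a
    ... | yes _  = cong suc (same t)
    ... | no a≢a = contradiction refl a≢a
  ... | no a≢b = trans (different t) (sym (lookup-mono-≢ t a≢b))
    where
    different : ∀ t → occ a (List.replicate t b) ≡ 0
    different zero = refl
    different (suc t) with a ≟ b
    ... | yes a≡b = contradiction a≡b a≢b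
    ... | no _    = different t

  occ-baseWord : ∀ a t → occ a (baseWord n (λ _ → t)) ≡ t
  occ-baseWord a t = trans (blocks (allFin n)) (lookup-exponent-allFin t a)
    where
    blocks : ∀ bs → occ a (concatMap (λ b → List.replicate t b) bs) ≡ lookup (exponent t bs) a
    blocks []       = sym (Vecₚ.lookup-replicate a 0)
    blocks (b ∷ bs) = trans (occ-++ a (List.replicate t b) _)
      (trans (cong₂ _+_ (occ-replicate a t b) (blocks bs)) (sym (lookup-∙ a (mono t b) _)))

  opaque
    unfolding indicator
    isRearrangement-indicator : ∀ t w →
      (if isRearrangement w (baseWord n (λ _ → t)) then 1 else 0) ≡ indicator t (exponent 1 w)
    isRearrangement-indicator t w = cong (λ bs → if and bs then 1 else 0)
      (map-cong (λ a → cong₂ (λ j k → ⌊ j ℕ.≟ k ⌋) (occ-exponent a w) (occ-baseWord a t)) (allFin n))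

  ∏Q-baseWord : ∀ t → ∏ₗ Q (baseWord n (λ _ → t)) ≈ ∏ₗ (λ b → Q b ^ t) (allFin n)
  ∏Q-baseWord t = blocks (allFin n)
    where
    block : ∀ t b → ∏ₗ Q (List.replicate t b) ≈ Q b ^ t
    block zero    b = R.refl
    block (suc t) b = R.*-congˡ (block t b)
    blocks : ∀ bs → ∏ₗ Q (concatMap (λ b → List.replicate t b) bs) ≈ ∏ₗ (λ b → Q b ^ t) bs
    blocks []       = R.refl
    blocks (b ∷ bs) = R.trans (∏ₗ-++ Q (List.replicate t b) _) (R.*-cong (block t b) (blocks bs))

  P′-coefficient : ∀ t → P′ n (λ _ → t) ≡ φ t (∏ₗ (λ b → Q b ^ t) (allFin n))
  P′-coefficient t = begin
    P′ n (λ _ → t)  ≡⟨ length-filter-T? (λ w → isRearrangement w v ∧ noFixedLetter w v) words ⟩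
    ∑ℕ (λ w → if isRearrangement w v ∧ noFixedLetter w v then 1 else 0) words ≡⟨ ∑ℕ-cong split words ⟩
    ∑ℕ (λ w → if noFixedLetter w v then indicator t (exponent 1 w) else 0) words ≡⟨ eval-∏Q v (indicator t) ⟨
    φ t (∏ₗ Q v)    ≡⟨ φ-cong t (∏Q-baseWord t) ⟩
    φ t (∏ₗ (λ b → Q b ^ t) (allFin n)) ∎
    where
    v = baseWord n (λ _ → t)
    words = allWords n (length v)
    split : ∀ w → (if isRearrangement w v ∧ noFixedLetter w v then 1 else 0)
                ≡ (if noFixedLetter w v then indicator t (exponent 1 w) else 0)
    split w = trans (∧-if (isRearrangement w v) (noFixedLetter w v))
      (cong (λ k → if noFixedLetter w v then k else 0) (isRearrangement-indicator t w))
      where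
      ∧-if : ∀ b c → (if b ∧ c then 1 else 0) ≡ (if c then (if b then 1 else 0) else 0)
      ∧-if true  true  = refl
      ∧-if true  false = refl
      ∧-if false true  = refl
      ∧-if false false = refl

-- Products of the remainders, up to monomials with an exponent not divisible by p.

module Multiples (n : ℕ) {q : ℕ} (pr : Prime (suc q)) where
  open Polynomials n
  open PrimeBinomials pr
  open Frobenius c c-spec
  open import Algebra.Solver.Ring.NaturalCoefficients.Default semiring using (solve; _:=_; _:+_; _:*_)
  open import Algebra.Properties.CommutativeMonoid.Mult (CommutativeSemiring.+-commutativeMonoid semiring) using (×-distrib-+)

  x y : Fin n → Poly
  x = var 1
  y = var p

  x^-var : ∀ k a → x a ^ k ≈ var k a
  x^-var zero    a = R.reflexive (cong monomial (sym (Vecₚ.updateAt-id-local a (replicate n 0) (sym (Vecₚ.lookup-replicate a 0)))))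
  x^-var (suc k) a = R.trans (R.*-congˡ (x^-var k a)) (R.trans (monomial-⊗ (mono 1 a) (mono k a)) (R.reflexive (cong monomial (mono-+ a))))
    where
    mono-+ : ∀ {n} (a : Fin n) → zipWith _+_ (replicate n 0 [ a ]≔ 1) (replicate n 0 [ a ]≔ k) ≡ replicate n 0 [ a ]≔ suc k
    mono-+ zero    = cong (suc k Vec.∷_) (Vecₚ.zipWith-identityˡ ℕ.+-identityˡ _)
    mono-+ (suc a) = cong (0 Vec.∷_) (mono-+ a)

  Supported : (Vec ℕ n → ℕ) → Set
  Supported f = ∀ m a → ¬ p ∣ℕ lookup m a → f m ≡ 0

  -- Equality of the parts whose exponents are all divisible by p.
  infix 4 _~_
  record _~_ (P Q : Poly) : Set where
    constructor mk~
    field at~ : ∀ f → Supported f → ⟨ P , f ⟩ ≡ ⟨ Q , f ⟩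
  open _~_ public

  ≈⇒~ : ∀ {P Q} → P ≈ Q → P ~ Q
  ≈⇒~ e = mk~ λ f _ → at e f

  ~-refl : ∀ {P} → P ~ P
  ~-refl = mk~ λ _ _ → refl

  ~-trans : ∀ {P Q S} → P ~ Q → Q ~ S → P ~ S
  ~-trans e e′ = mk~ λ f s → trans (at~ e f s) (at~ e′ f s)

  ~-⊕ : ∀ {P P′ Q Q′} → P ~ P′ → Q ~ Q′ → P ⊕ Q ~ P′ ⊕ Q′
  ~-⊕ {P} {P′} {Q} {Q′} e e′ = mk~ λ f s →
    trans (eval-⊕ P Q f) (trans (cong₂ _+_ (at~ e f s) (at~ e′ f s)) (sym (eval-⊕ P′ Q′ f)))

  ~-× : ∀ k {P Q} → P ~ Q → k × P ~ k × Q
  ~-× zero    e = ~-refl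
  ~-× (suc k) e = ~-⊕ e (~-× k e)

  ~-sum : ∀ {k} {s t : Fin k → Poly} → (∀ i → s i ~ t i) → sum s ~ sum t
  ~-sum {zero}  e = ~-refl
  ~-sum {suc k} e = ~-⊕ (e zero) (~-sum (λ i → e (suc i)))

  -- `~` is not a congruence for `⊗`: two discarded monomials, such as x_a and x_a to the power p -
  -- 1, can have a retained product. Multiplication by `y a` is safe, since it shifts exponents by
  -- multiples of p only.
  ~-y : ∀ a {P Q} → P ~ Q → y a ⊗ P ~ y a ⊗ Q
  ~-y a {P} {Q} e = mk~ λ f s →
    trans (eval-var-⊗ p a P f) (trans (at~ e _ (shifted f s)) (sym (eval-var-⊗ p a Q f)))
    where
    p∣mono : ∀ b → p ∣ℕ lookup (mono p a) b
    p∣mono b with b Finₚ.≟ a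
    ... | yes refl = subst (p ∣ℕ_) (sym (lookup-mono p a)) ∣-refl
    ... | no  b≢a  = subst (p ∣ℕ_) (sym (lookup-mono-≢ p b≢a)) (divides 0 refl)
    shifted : ∀ f → Supported f → Supported (λ m → f (mono p a ∙ m))
    shifted f s m b p∤m = s _ b λ p∣ → p∤m (∣m+n∣m⇒∣n (subst (p ∣ℕ_) (lookup-∙ b (mono p a) m) p∣) (p∣mono b))

  ~-∑y : ∀ as {P Q} → P ~ Q → ∑ₗ y as ⊗ P ~ ∑ₗ y as ⊗ Q
  ~-∑y []       e = ~-trans (≈⇒~ (R.zeroˡ _)) (≈⇒~ (R.sym (R.zeroˡ _)))
  ~-∑y (a ∷ as) e = ~-trans (≈⇒~ (R.distribʳ _ _ _))
    (~-trans (~-⊕ (~-y a e) (~-∑y as e)) (≈⇒~ (R.sym (R.distribʳ _ _ _))))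

  ~-∏∑y : ∀ {A : Set} (as : A → List (Fin n)) L {P Q} → P ~ Q →
    ∏ₗ (λ b → ∑ₗ y (as b)) L ⊗ P ~ ∏ₗ (λ b → ∑ₗ y (as b)) L ⊗ Q
  ~-∏∑y as []      e = ~-trans (≈⇒~ (R.*-identityˡ _)) (~-trans e (≈⇒~ (R.sym (R.*-identityˡ _))))
  ~-∏∑y as (b ∷ L) e = ~-trans (≈⇒~ (R.*-assoc _ _ _))
    (~-trans (~-∑y (as b) (~-∏∑y as L e)) (≈⇒~ (R.sym (R.*-assoc _ _ _))))

  𝟘⊕𝟘~𝟘 : ∀ {P Q} → P ~ 𝟘 → Q ~ 𝟘 → P ⊕ Q ~ 𝟘
  𝟘⊕𝟘~𝟘 e e′ = ~-trans (~-⊕ e e′) (≈⇒~ (R.+-identityˡ 𝟘))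

  ×-~𝟘 : ∀ k {P} → P ~ 𝟘 → k × P ~ 𝟘
  ×-~𝟘 zero    e = ~-refl
  ×-~𝟘 (suc k) e = 𝟘⊕𝟘~𝟘 e (×-~𝟘 k e)

  sum-~𝟘 : ∀ {k} {t : Fin k → Poly} → (∀ i → t i ~ 𝟘) → sum t ~ 𝟘
  sum-~𝟘 {zero}  e = ~-refl
  sum-~𝟘 {suc k} e = 𝟘⊕𝟘~𝟘 (e zero) (sum-~𝟘 (λ i → e (suc i)))

  sum-~-single : ∀ {k} (t : Fin k → Poly) j → (∀ i → i ≢ j → t i ~ 𝟘) → sum t ~ t j
  sum-~-single t zero    e = ~-trans (~-⊕ ~-refl (sum-~𝟘 (λ i → e (suc i) (λ ())))) (≈⇒~ (R.+-identityʳ _))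
  sum-~-single t (suc j) e = ~-trans
    (~-⊕ (e zero (λ ())) (sum-~-single (λ i → t (suc i)) j (λ i i≢j → e (suc i) (λ eq → i≢j (Finₚ.suc-injective eq)))))
    (≈⇒~ (R.+-identityˡ _))

  -- Every monomial of P has exponent k at a; stated so as to be invariant under ≈.
  record Degree (a : Fin n) (k : ℕ) (P : Poly) : Set where
    constructor mkDegree
    field vanishes : ∀ f → (∀ m → lookup m a ≡ k → f m ≡ 0) → ⟨ P , f ⟩ ≡ 0
  open Degree

  degree⇒~𝟘 : ∀ {a k P} → Degree a k P → ¬ p ∣ℕ k → P ~ 𝟘
  degree⇒~𝟘 {a} d p∤k = mk~ λ f s →
    trans (vanishes d f (λ m eq → s m a (subst (λ j → ¬ p ∣ℕ j) (sym eq) p∤k))) (sym (eval-𝟘 f))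

  degree-𝟘 : ∀ {a k} → Degree a k 𝟘
  degree-𝟘 = mkDegree λ f _ → eval-𝟘 f

  degree-𝟙 : ∀ {a} → Degree a 0 R.1#
  degree-𝟙 {a} = mkDegree λ f v → trans (eval-monomial _ f) (v _ (Vecₚ.lookup-replicate a 0))

  degree-⊕ : ∀ {a k P Q} → Degree a k P → Degree a k Q → Degree a k (P ⊕ Q)
  degree-⊕ {P = P} {Q} d d′ = mkDegree λ f v → trans (eval-⊕ P Q f) (cong₂ _+_ (vanishes d f v) (vanishes d′ f v))

  degree-⊗ : ∀ {a k l P Q} → Degree a k P → Degree a l Q → Degree a (k + l) (P ⊗ Q)
  degree-⊗ {a} {P = P} {Q} d d′ = mkDegree λ f v → trans (eval-⊗ P Q f)
    (vanishes d _ (λ m m≡ → vanishes d′ _ (λ k k≡ → v _ (trans (lookup-∙ a m k) (cong₂ _+_ m≡ k≡)))))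

  degree-⊗₀ : ∀ {a k P Q} → Degree a k P → Degree a 0 Q → Degree a k (P ⊗ Q)
  degree-⊗₀ {a} {k} {P} {Q} d d′ = subst (λ j → Degree a j (P ⊗ Q)) (ℕ.+-identityʳ k) (degree-⊗ d d′)

  degree-× : ∀ {a k P} j → Degree a k P → Degree a k (j × P)
  degree-× zero    d = degree-𝟘
  degree-× (suc j) d = degree-⊕ d (degree-× j d)

  degree-^₀ : ∀ {a P} j → Degree a 0 P → Degree a 0 (P ^ j)
  degree-^₀ zero    d = degree-𝟙
  degree-^₀ (suc j) d = degree-⊗ d (degree-^₀ j d)

  degree-sum : ∀ {a k l} {t : Fin l → Poly} → (∀ i → Degree a k (t i)) → Degree a k (sum t)
  degree-sum {l = zero}  d = degree-𝟘
  degree-sum {l = suc l} d = degree-⊕ (d zero) (degree-sum (λ i → d (suc i)))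

  degree-x : ∀ a → Degree a 1 (x a)
  degree-x a = mkDegree λ f v → trans (eval-monomial _ f) (v _ (lookup-mono 1 a))

  degree-x^ : ∀ a j → Degree a j (x a ^ j)
  degree-x^ a zero    = degree-𝟙
  degree-x^ a (suc j) = degree-⊗ (degree-x a) (degree-x^ a j)

  degree-x-≢ : ∀ {a b} → b ≢ a → Degree a 0 (x b)
  degree-x-≢ b≢a = mkDegree λ f v → trans (eval-monomial _ f) (v _ (lookup-mono-≢ 1 (≢-sym b≢a)))

  degree-∑x : ∀ {a as} → All (_≢ a) as → Degree a 0 (∑ₗ x as)
  degree-∑x []         = degree-𝟘
  degree-∑x (b≢a ∷ as) = degree-⊕ (degree-x-≢ b≢a) (degree-∑x as)

  degree-remainder : ∀ {a as} → All (_≢ a) as → Degree a 0 (remainder x as)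
  degree-remainder []         = degree-𝟘
  degree-remainder (b≢a ∷ as) = degree-⊕
    (degree-sum (λ i → degree-× (c i) (degree-⊗ (degree-^₀ (suc (toℕ i)) (degree-x-≢ b≢a)) (degree-^₀ (q ∸ toℕ i) (degree-∑x as)))))
    (degree-remainder as)

  degree-middleTerm : ∀ {a S} → Degree a 0 S → ∀ i → Degree a (suc (toℕ i)) (middleTerm (x a) S i)
  degree-middleTerm {a} d i = degree-× (c i) (degree-⊗₀ (degree-x^ a (suc (toℕ i))) (degree-^₀ (q ∸ toℕ i) d))

  -- Neither `S` nor `W` contains the letter `a`, so nothing can complete its exponent, which lies
  -- strictly between 0 and p.
  middle-⊗-~𝟘 : ∀ {a S W} → Degree a 0 S → Degree a 0 W → middle (x a) S ⊗ W ~ 𝟘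
  middle-⊗-~𝟘 {a} {S} {W} d d′ = ~-trans (≈⇒~ (*-distribʳ-sum W (middleTerm (x a) S)))
    (sum-~𝟘 λ i → degree⇒~𝟘 (degree-⊗₀ (degree-middleTerm d i) d′)
      λ p∣ → ℕ.<⇒≱ (ℕ.s<s (Finₚ.toℕ<n i)) (∣⇒≤ p∣))

  middle-~𝟘 : ∀ {a S} → Degree a 0 S → middle (x a) S ~ 𝟘
  middle-~𝟘 d = ~-trans (≈⇒~ (R.sym (R.*-identityʳ _))) (middle-⊗-~𝟘 d degree-𝟙)

  opposite-sum : ∀ (i : Fin q) → suc (toℕ i) + suc (toℕ (opposite i)) ≡ p
  opposite-sum i = trans (cong (λ k → suc (toℕ i) + suc k) (Finₚ.opposite-prop i))
    (trans (ℕ.+-suc (suc (toℕ i)) _) (cong suc (ℕ.m+[n∸m]≡n (Finₚ.toℕ<n i))))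

  opposite-diff : ∀ (i : Fin q) → (q ∸ toℕ i) + (q ∸ toℕ (opposite i)) ≡ p
  opposite-diff i = trans (cong (λ k → (q ∸ toℕ i) + (q ∸ k)) (Finₚ.opposite-prop i))
    (trans (cong (q ∸ toℕ i +_) (ℕ.m∸[m∸n]≡n (Finₚ.toℕ<n i)))
      (trans (ℕ.+-suc (q ∸ toℕ i) (toℕ i)) (cong suc (ℕ.m∸n+n≡m (ℕ.<⇒≤ (Finₚ.toℕ<n i))))))

  -- Both summands are positive and less than p, so the only multiple of p within reach is p itself.
  p∣sum⇒opposite : ∀ (i j : Fin q) → p ∣ℕ suc (toℕ i) + suc (toℕ j) → j ≡ opposite i
  p∣sum⇒opposite i j (divides k eq) = Finₚ.toℕ-injective (ℕ.suc-injective
    (ℕ.+-cancelˡ-≡ (suc (toℕ i)) _ _ (trans (once k eq) (sym (opposite-sum i)))))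
    where
    once : ∀ k → suc (toℕ i) + suc (toℕ j) ≡ k * p → suc (toℕ i) + suc (toℕ j) ≡ p
    once (suc zero)    eq = trans eq (ℕ.+-identityʳ p)
    once (suc (suc k)) eq = contradiction
      (subst (p + p ℕ.≤_) (sym eq) (ℕ.+-monoʳ-≤ p (ℕ.m≤m+n p (k * p))))
      (ℕ.<⇒≱ (ℕ.+-mono-< (ℕ.s<s (Finₚ.toℕ<n i)) (ℕ.s<s (Finₚ.toℕ<n j))))

  -- In the double sum, term `i` is completed to an exponent of x_a divisible by p only by term
  -- `opposite i`. The exponents of `S` then add up to p as well, and the coefficients add up to
  -- `w`.
  middle-² : ∀ {a S} → Degree a 0 S → middle (x a) S ⊗ middle (x a) S ~ w × (y a ⊗ S ^ p)
  middle-² {a} {S} d = ~-trans (≈⇒~ (*-distribʳ-sum (middle (x a) S) t))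
    (~-trans (~-sum row) (≈⇒~ (sum-× (λ i → c i * c (opposite i)))))
    where
    t = middleTerm (x a) S
    Z = y a ⊗ S ^ p

    sum-× : ∀ {l} (k : Fin l → ℕ) → sum (λ i → k i × Z) ≈ ℕSum.sum k × Z
    sum-× {zero}  k = R.refl
    sum-× {suc l} k = R.trans (R.+-congˡ (sum-× (λ i → k (suc i)))) (R.sym (×-homo-+ Z (k zero) _))

    product : ∀ i j → t i ⊗ t j ≈
      (c i * c j) × (x a ^ (suc (toℕ i) + suc (toℕ j)) ⊗ S ^ ((q ∸ toℕ i) + (q ∸ toℕ j)))
    product i j = R.trans (×-assoc-* (c i) _ _) (R.trans (×-congʳ (c i) (×-comm-* (c j) _ _))
      (R.trans (×-assocˡ _ (c i) (c j)) (×-congʳ (c i * c j)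
        (R.trans (solve 4 (λ u v u′ v′ → (u :* v) :* (u′ :* v′) := (u :* u′) :* (v :* v′)) R.refl
                   (x a ^ suc (toℕ i)) (S ^ (q ∸ toℕ i)) (x a ^ suc (toℕ j)) (S ^ (q ∸ toℕ j)))
          (R.sym (R.*-cong (^-homo-* (x a) (suc (toℕ i)) (suc (toℕ j))) (^-homo-* S (q ∸ toℕ i) (q ∸ toℕ j))))))))

    row : ∀ i → t i ⊗ middle (x a) S ~ (c i * c (opposite i)) × Z
    row i = ~-trans (≈⇒~ (*-distribˡ-sum (t i) t))
      (~-trans (sum-~-single (λ j → t i ⊗ t j) (opposite i) λ j j≢ →
                 degree⇒~𝟘 (degree-⊗ (degree-middleTerm d i) (degree-middleTerm d j)) (λ p∣ → j≢ (p∣sum⇒opposite i j p∣)))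
        (≈⇒~ (R.trans (product i (opposite i)) (×-congʳ (c i * c (opposite i))
          (R.*-cong (R.trans (^-congʳ (x a) (opposite-sum i)) (x^-var p a)) (^-congʳ S (opposite-diff i)))))))

  ∉⇒≢ : ∀ {a : Fin n} {as} → All (a ≢_) as → All (_≢ a) as
  ∉⇒≢ = All.map ≢-sym

  remainder-~𝟘 : ∀ {as} → Unique as → remainder x as ~ 𝟘
  remainder-~𝟘 []         = ~-refl
  remainder-~𝟘 (a∉as ∷ u) = 𝟘⊕𝟘~𝟘 (middle-~𝟘 (degree-∑x (∉⇒≢ a∉as))) (remainder-~𝟘 u)

  frobenius-y : ∀ as → ∑ₗ x as ^ p ≈ ∑ₗ y as ⊕ p × remainder x as
  frobenius-y as = R.trans (frobenius-∑ₗ x as) (R.+-congʳ (powers as))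
    where
    powers : ∀ as → ∑ₗ (λ a → x a ^ p) as ≈ ∑ₗ y as
    powers []       = R.refl
    powers (a ∷ as) = R.+-cong (x^-var p a) (powers as)

  ∑x^p-~ : ∀ {as} → Unique as → ∑ₗ x as ^ p ~ ∑ₗ y as
  ∑x^p-~ {as} u = ~-trans (≈⇒~ (frobenius-y as))
    (~-trans (~-⊕ ~-refl (×-~𝟘 p (remainder-~𝟘 u))) (≈⇒~ (R.+-identityʳ _)))

  -- The second elementary symmetric polynomial in the y_a.
  e₂ : List (Fin n) → Poly
  e₂ []       = 𝟘
  e₂ (a ∷ as) = y a ⊗ ∑ₗ y as ⊕ e₂ as

  -- The remainder is `~ 𝟘`, but its square is not. With `a` peeled off, the cross terms vanish
  -- because `a` occurs in only one factor; the square of the middle part gives w y_a times a p-th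
  -- power, which is again a sum of y's up to `~`.
  remainder-² : ∀ {as} → Unique as → remainder x as ⊗ remainder x as ~ w × e₂ as
  remainder-² {[]}     []         = ~-trans (≈⇒~ (R.zeroˡ 𝟘)) (mk~ λ f s → sym (at~ (×-~𝟘 w ~-refl) f s))
  remainder-² {a ∷ as} (a∉as ∷ u) = ~-trans
    (≈⇒~ (solve 2 (λ m b → (m :+ b) :* (m :+ b) := (m :* m) :+ ((m :* b) :+ ((m :* b) :+ (b :* b)))) R.refl m B))
    (~-trans (~-⊕ (~-trans (middle-² dS) (~-× w (~-y a (∑x^p-~ u)))) (~-⊕ mB (~-⊕ mB (remainder-² u))))
      (≈⇒~ (R.trans (R.+-congˡ (R.trans (R.+-identityˡ _) (R.+-identityˡ _))) (R.sym (×-distrib-+ _ _ w)))))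
    where
    m = middle (x a) (∑ₗ x as)
    B = remainder x as
    dS = degree-∑x (∉⇒≢ a∉as)
    mB : m ⊗ B ~ 𝟘
    mB = middle-⊗-~𝟘 dS (degree-remainder (∉⇒≢ a∉as))

  -- Row i lacks the letter i and row j lacks j, so each of these letters occurs in one factor only
  -- and its middle terms vanish. What is left is the square of the common remainder.
  remainder-pair : ∀ {i j as} → Unique (i ∷ j ∷ as) →
    remainder x (j ∷ as) ⊗ remainder x (i ∷ as) ~ w × e₂ as
  remainder-pair {i} {j} {as} ((i≢j ∷ i∉as) ∷ (j∉as ∷ u)) = ~-trans
    (≈⇒~ (solve 3 (λ m m′ b → (m :+ b) :* (m′ :+ b) := (m :* (m′ :+ b)) :+ ((m′ :* b) :+ (b :* b))) R.refl
      (middle (x j) (∑ₗ x as)) (middle (x i) (∑ₗ x as)) (remainder x as)))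
    (~-trans (~-⊕ (middle-⊗-~𝟘 (degree-∑x (∉⇒≢ j∉as)) (degree-remainder (i≢j ∷ ∉⇒≢ j∉as)))
               (~-⊕ (middle-⊗-~𝟘 (degree-∑x (∉⇒≢ i∉as)) (degree-remainder (∉⇒≢ i∉as))) (remainder-² u)))
      (≈⇒~ (R.trans (R.+-identityˡ _) (R.+-identityˡ _))))

  -- The recursive definition depends on the order of the letters, but the other two terms of the
  -- Frobenius identity do not. Evaluations lie in ℕ, where the common summand and the factor p
  -- cancel.
  remainder-↭ : ∀ {as bs} → as ↭ bs → remainder x as ≈ remainder x bs
  remainder-↭ {as} {bs} e = mk≈ λ f → ℕ.*-cancelˡ-≡ _ _ p (ℕ.+-cancelˡ-≡ ⟨ ∑ₗ y as , f ⟩ _ _ (begin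
    ⟨ ∑ₗ y as , f ⟩ + p * ⟨ remainder x as , f ⟩  ≡⟨ expand as f ⟨
    ⟨ ∑ₗ x as ^ p , f ⟩                           ≡⟨ at (^-congˡ p (∑ₗ-↭ x e)) f ⟩
    ⟨ ∑ₗ x bs ^ p , f ⟩                           ≡⟨ expand bs f ⟩
    ⟨ ∑ₗ y bs , f ⟩ + p * ⟨ remainder x bs , f ⟩  ≡⟨ cong (_+ p * ⟨ remainder x bs , f ⟩) (at (∑ₗ-↭ y e) f) ⟨
    ⟨ ∑ₗ y as , f ⟩ + p * ⟨ remainder x bs , f ⟩  ∎))
    where
    open ≡-Reasoning
    expand : ∀ as f → ⟨ ∑ₗ x as ^ p , f ⟩ ≡ ⟨ ∑ₗ y as , f ⟩ + p * ⟨ remainder x as , f ⟩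
    expand as f = trans (at (frobenius-y as) f)
      (trans (eval-⊕ (∑ₗ y as) _ f) (cong (⟨ ∑ₗ y as , f ⟩ +_) (eval-× p (remainder x as) f)))

-- The product of the two pair counts is a multiple of 6.

-- The binomial coefficient C(l,2), in the recursive form that inductions over lists produce.
pairs : ℕ → ℕ
pairs zero    = 0
pairs (suc l) = l + pairs l

2*pairs : ∀ l → 2 * pairs l + l ≡ l * l
2*pairs zero    = refl
2*pairs (suc l) = begin
  2 * (l + pairs l) + suc l       ≡⟨ regroup l (pairs l) ⟩
  2 * pairs l + l + (2 * l + 1)   ≡⟨ cong (_+ (2 * l + 1)) (2*pairs l) ⟩
  l * l + (2 * l + 1)             ≡⟨ square l ⟩
  suc l * suc l                   ∎
  where
  open ≡-Reasoning
  regroup : ∀ l P → 2 * (l + P) + suc l ≡ 2 * P + l + (2 * l + 1)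
  regroup = solve-∀
  square : ∀ l → l * l + (2 * l + 1) ≡ suc l * suc l
  square = solve-∀

-- Consecutive values differ by 3(l+1)(l+2) = 6 C(l+2,2).
6∣l[l+1][l+2] : ∀ l → 6 ∣ℕ l * suc l * (2 + l)
6∣l[l+1][l+2] zero    = divides 0 refl
6∣l[l+1][l+2] (suc l) = subst (6 ∣ℕ_) step (∣m∣n⇒∣m+n (6∣l[l+1][l+2] l) (∣m⇒∣m*n (pairs (2 + l)) ∣-refl))
  where
  open ≡-Reasoning
  regroup : ∀ l P → l * suc l * (2 + l) + 6 * P + 3 * (2 + l) ≡ l * suc l * (2 + l) + 3 * (2 * P + (2 + l))
  regroup = solve-∀
  final : ∀ l → l * suc l * (2 + l) + 3 * ((2 + l) * (2 + l)) ≡ suc l * (2 + l) * (3 + l) + 3 * (2 + l)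
  final = solve-∀
  step : l * suc l * (2 + l) + 6 * pairs (2 + l) ≡ suc l * (2 + l) * (3 + l)
  step = ℕ.+-cancelʳ-≡ (3 * (2 + l)) _ _ (begin
    l * suc l * (2 + l) + 6 * pairs (2 + l) + 3 * (2 + l)          ≡⟨ regroup l (pairs (2 + l)) ⟩
    l * suc l * (2 + l) + 3 * (2 * pairs (2 + l) + (2 + l))        ≡⟨ cong (λ u → l * suc l * (2 + l) + 3 * u) (2*pairs (2 + l)) ⟩
    l * suc l * (2 + l) + 3 * ((2 + l) * (2 + l))                  ≡⟨ final l ⟩
    suc l * (2 + l) * (3 + l) + 3 * (2 + l)                        ∎)

-- The product is 6 C(l+2,4). Its consecutive differences are l(l+1)(l+2), which reduces the claim
-- to the preceding divisibility.
6∣pairs*pairs : ∀ l → 6 ∣ℕ pairs (2 + l) * pairs l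
6∣pairs*pairs zero    = divides 0 refl
6∣pairs*pairs (suc l) = subst (6 ∣ℕ_) step (∣m∣n⇒∣m+n (6∣pairs*pairs l) (6∣l[l+1][l+2] l))
  where
  open ≡-Reasoning
  P = pairs l
  before : ∀ l P → (suc l + (l + P)) * P + l * suc l * (2 + l) + suc l * l
                 ≡ (suc l + (l + P)) * P + 3 * l * suc l + suc l * (l * l)
  before = solve-∀
  after : ∀ l P → (suc l + (l + P)) * P + 3 * l * suc l + suc l * (2 * P + l)
                ≡ (2 + l + (suc l + (l + P))) * (l + P) + suc l * l
  after = solve-∀
  step : pairs (2 + l) * P + l * suc l * (2 + l) ≡ pairs (3 + l) * pairs (suc l)
  -- The summand `suc l * l` is added on both sides so that `l * l` can be exchanged for
  -- `2 * pairs l + l` without subtracting.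
  step = ℕ.+-cancelʳ-≡ (suc l * l) _ _ (begin
    pairs (2 + l) * P + l * suc l * (2 + l) + suc l * l         ≡⟨ before l P ⟩
    pairs (2 + l) * P + 3 * l * suc l + suc l * (l * l)         ≡⟨ cong (λ u → pairs (2 + l) * P + 3 * l * suc l + suc l * u) (2*pairs l) ⟨
    pairs (2 + l) * P + 3 * l * suc l + suc l * (2 * P + l)     ≡⟨ after l P ⟩
    pairs (3 + l) * pairs (suc l) + suc l * l                   ∎)

-- The contributions of order 0, 1 and 2 in p, and the congruence.

module Assembly (n : ℕ) {q : ℕ} (pr : Prime (suc q)) where
  open Polynomials n
  open PrimeBinomials pr using (p; c; c-spec; w; p∣6w)
  open Frobenius c c-spec using (remainder)
  open Multiples n pr
  open WordCount n using (Q)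
  open Values n p using (A; s; s≈y+A; φ-square; φ-value)
  open import Algebra.Solver.Ring.NaturalCoefficients.Default semiring using (solve; _:=_; _:+_; _:*_)
  open ≡-Reasoning

  φₚ : Poly → ℕ
  φₚ = φ p

  B : Fin n → Poly
  B b = remainder x (others b)

  -- The target monomial has all exponents equal to p, so its coefficient sees only what `~`
  -- retains.
  φ-~ : ∀ {P P′} → P ~ P′ → φₚ P ≡ φₚ P′
  φ-~ e = at~ e (indicator p) λ m a p∤ → indicator-0 p m a λ eq → p∤ (subst (p ∣ℕ_) (sym eq) ∣-refl)

  φ-⊗-⊕ : ∀ W P P′ → φₚ (W ⊗ (P ⊕ P′)) ≡ φₚ (W ⊗ P) + φₚ (W ⊗ P′)
  φ-⊗-⊕ W P P′ = trans (φ-cong p (R.distribˡ W P P′)) (φ-⊕ p (W ⊗ P) (W ⊗ P′))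

  φ-⊗-𝟘 : ∀ W → φₚ (W ⊗ 𝟘) ≡ 0
  φ-⊗-𝟘 W = trans (φ-cong p (R.zeroʳ W)) (eval-𝟘 _)

  length-↭-allFin : ∀ {as} → as ↭ allFin n → length as ≡ n
  length-↭-allFin e = trans (↭-length e) (length-tabulate {n = n} (λ i → i))

  -- y_a (s - y_a) may be replaced by y_a s, because y_a² does not contribute.
  φ-letters : ∀ {i j a b rest} → i ∷ j ∷ a ∷ b ∷ rest ↭ allFin n →
    φₚ (∏ₗ A (a ∷ b ∷ rest) ⊗ (y a ⊗ y b)) ≡ rencontres 2 (length rest)
  φ-letters {i} {j} {a} {b} {rest} e = begin
    φₚ P                            ≡⟨ cong₂ (λ u v → u + (v + φₚ P)) (φ-square a _) (φ-square b _) ⟨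
    φₚ (y a ⊗ (y a ⊗ Pa)) + (φₚ (y b ⊗ (y b ⊗ Pb)) + φₚ P)
      ≡⟨ cong (λ u → φₚ (y a ⊗ (y a ⊗ Pa)) + u) (φ-⊕ p (y b ⊗ (y b ⊗ Pb)) P) ⟨
    φₚ (y a ⊗ (y a ⊗ Pa)) + φₚ (y b ⊗ (y b ⊗ Pb) ⊕ P)
      ≡⟨ φ-⊕ p (y a ⊗ (y a ⊗ Pa)) _ ⟨
    φₚ (y a ⊗ (y a ⊗ Pa) ⊕ (y b ⊗ (y b ⊗ Pb) ⊕ P)) ≡⟨ φ-cong p combine ⟩
    φₚ (∏ₗ y (a ∷ b ∷ []) ⊗ ((s ⊗ (s ⊗ R.1#)) ⊗ W))  ≡⟨ φ-value rest (a ∷ b ∷ []) (i ∷ j ∷ []) e′ ⟩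
    rencontres 2 (length rest)      ∎
    where
    W = ∏ₗ A rest
    P = ∏ₗ A (a ∷ b ∷ rest) ⊗ (y a ⊗ y b)
    Pa = y b ⊗ ((y b ⊕ A b) ⊗ W)
    Pb = y a ⊗ (A a ⊗ W)
    e′ : a ∷ b ∷ rest ++ i ∷ j ∷ [] ↭ allFin n
    e′ = ↭-trans (++-comm (a ∷ b ∷ rest) (i ∷ j ∷ [])) e
    combine : y a ⊗ (y a ⊗ Pa) ⊕ (y b ⊗ (y b ⊗ Pb) ⊕ P) ≈ ∏ₗ y (a ∷ b ∷ []) ⊗ ((s ⊗ (s ⊗ R.1#)) ⊗ W)
    combine = R.trans
      (solve 5 (λ ya yb Aa Ab W →
          (ya :* (ya :* (yb :* ((yb :+ Ab) :* W)))) :+ ((yb :* (yb :* (ya :* (Aa :* W)))) :+ ((Aa :* (Ab :* W)) :* (ya :* yb)))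
          := (ya :* yb) :* (((ya :+ Aa) :* (yb :+ Ab)) :* W)) R.refl (y a) (y b) (A a) (A b) W)
      (R.*-cong (R.*-congˡ (R.sym (R.*-identityʳ (y b))))
        (R.*-congʳ (R.*-cong (R.sym (s≈y+A a)) (R.trans (R.sym (s≈y+A b)) (R.sym (R.*-identityʳ s))))))

  φ-letter-∑ : ∀ {i j a rest} pre bs → a ∷ pre ++ bs ↭ rest → i ∷ j ∷ rest ↭ allFin n →
    φₚ (∏ₗ A rest ⊗ (y a ⊗ ∑ₗ y bs)) ≡ length bs * rencontres 2 (n ∸ 4)
  φ-letter-∑ {rest = rest} pre [] e e′ = trans (φ-cong p (R.*-congˡ (R.zeroʳ _))) (φ-⊗-𝟘 (∏ₗ A rest))
  φ-letter-∑ {i} {j} {a} {rest} pre (b ∷ bs) e e′ = begin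
    φₚ (W ⊗ (y a ⊗ (y b ⊕ ∑ₗ y bs)))        ≡⟨ φ-cong p (R.*-congˡ (R.distribˡ (y a) (y b) _)) ⟩
    φₚ (W ⊗ (y a ⊗ y b ⊕ y a ⊗ ∑ₗ y bs))    ≡⟨ φ-⊗-⊕ W _ _ ⟩
    φₚ (W ⊗ (y a ⊗ y b)) + φₚ (W ⊗ (y a ⊗ ∑ₗ y bs)) ≡⟨ cong₂ _+_ first (φ-letter-∑ (b ∷ pre) bs moved e′) ⟩
    rencontres 2 (n ∸ 4) + length bs * rencontres 2 (n ∸ 4) ∎
    where
    W = ∏ₗ A rest
    moved : a ∷ b ∷ pre ++ bs ↭ rest
    moved = ↭-trans (prep a (↭-sym (shift b pre bs))) e
    whole : i ∷ j ∷ a ∷ b ∷ pre ++ bs ↭ allFin n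
    whole = ↭-trans (prep i (prep j moved)) e′
    first : φₚ (W ⊗ (y a ⊗ y b)) ≡ rencontres 2 (n ∸ 4)
    first = begin
      φₚ (W ⊗ (y a ⊗ y b))                              ≡⟨ φ-cong p (R.*-congʳ (R.sym (∏ₗ-↭ A moved))) ⟩
      φₚ (∏ₗ A (a ∷ b ∷ pre ++ bs) ⊗ (y a ⊗ y b))       ≡⟨ φ-letters whole ⟩
      rencontres 2 (length (pre ++ bs))                 ≡⟨ cong (λ k → rencontres 2 (k ∸ 4)) (length-↭-allFin whole) ⟩
      rencontres 2 (n ∸ 4)                              ∎

  φ-e₂ : ∀ {i j rest} pre bs → pre ++ bs ↭ rest → i ∷ j ∷ rest ↭ allFin n →
    φₚ (∏ₗ A rest ⊗ e₂ bs) ≡ pairs (length bs) * rencontres 2 (n ∸ 4)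
  φ-e₂ {rest = rest} pre [] e e′ = φ-⊗-𝟘 (∏ₗ A rest)
  φ-e₂ {rest = rest} pre (b ∷ bs) e e′ = begin
    φₚ (W ⊗ (y b ⊗ ∑ₗ y bs ⊕ e₂ bs))            ≡⟨ φ-⊗-⊕ W _ _ ⟩
    φₚ (W ⊗ (y b ⊗ ∑ₗ y bs)) + φₚ (W ⊗ e₂ bs)   ≡⟨ cong₂ _+_ (φ-letter-∑ pre bs moved e′) (φ-e₂ (b ∷ pre) bs moved e′) ⟩
    length bs * r + pairs (length bs) * r       ≡⟨ ℕ.*-distribʳ-+ r (length bs) _ ⟨
    (length bs + pairs (length bs)) * r         ∎
    where
    W = ∏ₗ A rest
    r = rencontres 2 (n ∸ 4)
    moved : b ∷ pre ++ bs ↭ rest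
    moved = ↭-trans (↭-sym (shift b pre bs)) e

  -- The contribution of one pair of rows i, j: `pairs (n ∸ 2)` choices of two letters a, b, each
  -- with coefficient `w` and `rencontres 2 (n ∸ 4)` completions. The 2 counts the letters i and j,
  -- forbidden in no remaining row. For n < 4 the truncated differences do no harm, as
  -- `pairs (n ∸ 2)` is then 0.
  pairValue : ℕ
  pairValue = w * (pairs (n ∸ 2) * rencontres 2 (n ∸ 4))

  -- With i and j listed first, both remainders take the shape required by `remainder-pair`. The
  -- other rows are sums of y's, so that relation may be applied underneath them.
  φ-rows : ∀ {i j rest} → i ∷ j ∷ rest ↭ allFin n → φₚ (∏ₗ A rest ⊗ (B i ⊗ B j)) ≡ pairValue
  φ-rows {i} {j} {rest} e = begin
    φₚ (W ⊗ (B i ⊗ B j))   ≡⟨ φ-cong p (R.*-congˡ (R.*-cong (remainder-↭ (others-↭ e)) (remainder-↭ (others-↭ (↭-trans (swap j i ↭-refl) e))))) ⟩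
    φₚ (W ⊗ (remainder x (j ∷ rest) ⊗ remainder x (i ∷ rest)))  ≡⟨ φ-~ (~-∏∑y others rest (remainder-pair (↭-unique e))) ⟩
    φₚ (W ⊗ (w × e₂ rest)) ≡⟨ φ-cong p (×-comm-* w W (e₂ rest)) ⟩
    φₚ (w × (W ⊗ e₂ rest)) ≡⟨ eval-× w _ _ ⟩
    w * φₚ (W ⊗ e₂ rest)   ≡⟨ cong (w *_) (φ-e₂ [] rest ↭-refl e) ⟩
    w * (pairs (length rest) * rencontres 2 (n ∸ 4)) ≡⟨ cong (λ k → w * (pairs (k ∸ 2) * rencontres 2 (n ∸ 4))) (length-↭-allFin e) ⟩
    pairValue              ∎
    where
    W = ∏ₗ A rest

  π : Poly
  π = p × R.1#

  open Expansion π A B public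

  -- `pre` lists the rows already passed, each of which contributed its `A`. A summand therefore
  -- shows one `B b` next to the `A` of every other row, and `B b` is `~ 𝟘`.
  φ-Z₁ : ∀ pre bs → pre ++ bs ↭ allFin n → φₚ (∏ₗ A pre ⊗ Z₁ bs) ≡ 0
  φ-Z₁ pre []       e = φ-⊗-𝟘 (∏ₗ A pre)
  φ-Z₁ pre (b ∷ bs) e = trans (φ-⊗-⊕ (∏ₗ A pre) _ _) (cong₂ _+_ first second)
    where
    moved : b ∷ pre ++ bs ↭ allFin n
    moved = ↭-trans (↭-sym (shift b pre bs)) e
    first : φₚ (∏ₗ A pre ⊗ (B b ⊗ ∏ₗ A bs)) ≡ 0
    first with ↭-unique (∷-others-↭ b)
    ... | _ ∷ u = begin
      φₚ (∏ₗ A pre ⊗ (B b ⊗ ∏ₗ A bs))   ≡⟨ φ-cong p (R.trans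
        (solve 3 (λ P B Q → P :* (B :* Q) := (P :* Q) :* B) R.refl (∏ₗ A pre) (B b) (∏ₗ A bs))
        (R.*-congʳ (R.sym (∏ₗ-++ A pre bs)))) ⟩
      φₚ (∏ₗ A (pre ++ bs) ⊗ B b)       ≡⟨ φ-~ (~-∏∑y others (pre ++ bs) (remainder-~𝟘 u)) ⟩
      φₚ (∏ₗ A (pre ++ bs) ⊗ 𝟘)         ≡⟨ φ-⊗-𝟘 _ ⟩
      0                                 ∎
    second : φₚ (∏ₗ A pre ⊗ (A b ⊗ Z₁ bs)) ≡ 0
    second = trans (φ-cong p (solve 3 (λ P A Z → P :* (A :* Z) := (A :* P) :* Z) R.refl (∏ₗ A pre) (A b) (Z₁ bs)))
      (φ-Z₁ (b ∷ pre) bs moved)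

  φ-B-Z₁ : ∀ i pre bs → i ∷ pre ++ bs ↭ allFin n → φₚ (∏ₗ A pre ⊗ (B i ⊗ Z₁ bs)) ≡ length bs * pairValue
  φ-B-Z₁ i pre []       e = trans (φ-cong p (R.*-congˡ (R.zeroʳ _))) (φ-⊗-𝟘 (∏ₗ A pre))
  φ-B-Z₁ i pre (b ∷ bs) e = begin
    φₚ (∏ₗ A pre ⊗ (B i ⊗ (B b ⊗ ∏ₗ A bs ⊕ A b ⊗ Z₁ bs)))
      ≡⟨ φ-cong p (R.trans
        (solve 6 (λ P Bi Bb Q Ab Z → P :* (Bi :* ((Bb :* Q) :+ (Ab :* Z)))
            := ((P :* Q) :* (Bi :* Bb)) :+ ((Ab :* P) :* (Bi :* Z))) R.refl (∏ₗ A pre) (B i) (B b) (∏ₗ A bs) (A b) (Z₁ bs))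
        (R.+-congʳ (R.*-congʳ (R.sym (∏ₗ-++ A pre bs))))) ⟩
    φₚ (∏ₗ A (pre ++ bs) ⊗ (B i ⊗ B b) ⊕ ∏ₗ A (b ∷ pre) ⊗ (B i ⊗ Z₁ bs)) ≡⟨ φ-⊕ p (∏ₗ A (pre ++ bs) ⊗ (B i ⊗ B b)) _ ⟩
    φₚ (∏ₗ A (pre ++ bs) ⊗ (B i ⊗ B b)) + φₚ (∏ₗ A (b ∷ pre) ⊗ (B i ⊗ Z₁ bs))
      ≡⟨ cong₂ _+_ (φ-rows moved) (φ-B-Z₁ i (b ∷ pre) bs moved) ⟩
    pairValue + length bs * pairValue ∎
    where
    moved : i ∷ b ∷ pre ++ bs ↭ allFin n
    moved = ↭-trans (prep i (↭-sym (shift b pre bs))) e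

  -- Each summand consists of two rows giving `B` and the remaining rows giving `A`; all these have
  -- the common value `pairValue`, so only the pairs of rows are counted.
  φ-Z₂ : ∀ pre bs → pre ++ bs ↭ allFin n → φₚ (∏ₗ A pre ⊗ Z₂ bs) ≡ pairs (length bs) * pairValue
  φ-Z₂ pre []       e = φ-⊗-𝟘 (∏ₗ A pre)
  φ-Z₂ pre (b ∷ bs) e = begin
    φₚ (∏ₗ A pre ⊗ (B b ⊗ Z₁ bs ⊕ A b ⊗ Z₂ bs))  ≡⟨ φ-⊗-⊕ (∏ₗ A pre) _ _ ⟩
    φₚ (∏ₗ A pre ⊗ (B b ⊗ Z₁ bs)) + φₚ (∏ₗ A pre ⊗ (A b ⊗ Z₂ bs))
      ≡⟨ cong₂ _+_ (φ-B-Z₁ b pre bs moved) second ⟩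
    length bs * pairValue + pairs (length bs) * pairValue ≡⟨ ℕ.*-distribʳ-+ pairValue (length bs) _ ⟨
    (length bs + pairs (length bs)) * pairValue  ∎
    where
    moved : b ∷ pre ++ bs ↭ allFin n
    moved = ↭-trans (↭-sym (shift b pre bs)) e
    second : φₚ (∏ₗ A pre ⊗ (A b ⊗ Z₂ bs)) ≡ pairs (length bs) * pairValue
    second = trans (φ-cong p (solve 3 (λ P A Z → P :* (A :* Z) := (A :* P) :* Z) R.refl (∏ₗ A pre) (A b) (Z₂ bs)))
      (φ-Z₂ (b ∷ pre) bs moved)

  -- The two pair counts supply the 6 that `p∣6w` asks for. Since 6 is never divided out, p = 2 and
  -- p = 3 need no separate treatment.
  p∣φ-Z₂ : p ∣ℕ pairs n * pairValue
  p∣φ-Z₂ = divisible n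
    where
    regroup : ∀ a w b r → a * b * w * r ≡ a * (w * (b * r))
    regroup = solve-∀
    divisible : ∀ n → p ∣ℕ pairs n * (w * (pairs (n ∸ 2) * rencontres 2 (n ∸ 4)))
    divisible zero          = divides 0 refl
    divisible (suc zero)    = divides 0 refl
    divisible (suc (suc l)) = subst (p ∣ℕ_) (regroup (pairs (2 + l)) w (pairs l) (rencontres 2 (2 + l ∸ 4)))
      (∣m⇒∣m*n (rencontres 2 (2 + l ∸ 4)) (∣-trans p∣6w (*-monoˡ-∣ w (6∣pairs*pairs l))))

  φ-π : ∀ P → φₚ (π ⊗ P) ≡ p * φₚ P
  φ-π P = trans (φ-cong p (R.trans (×-assoc-* p R.1# P) (×-congʳ p (R.*-identityˡ P)))) (eval-× p P _)

  -- The linear term is absent because its coefficient is 0, not merely divisible by p². The last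
  -- term carries p³ explicitly, so `Z₃` can stay unevaluated.
  P′-p : P′ n (λ _ → p) ≡ rencontres 0 n + (p * (p * (pairs n * pairValue)) + p * (p * (p * φₚ (Z₃ (allFin n)))))
  P′-p = begin
    P′ n (λ _ → p)                             ≡⟨ WordCount.P′-coefficient n p ⟩
    φₚ (∏ₗ (λ b → Q b ^ p) letters)               ≡⟨ φ-cong p (R.trans (∏ₗ-cong _ row letters) (expansion letters)) ⟩
    φₚ (∏ₗ A letters ⊕ (π ⊗ Z₁ letters ⊕ (π ⊗ (π ⊗ Z₂ letters) ⊕ π ⊗ (π ⊗ (π ⊗ Z₃ letters)))))
      ≡⟨ trans (φ-⊕ p (∏ₗ A letters) _) (cong (φₚ (∏ₗ A letters) +_) (trans (φ-⊕ p (π ⊗ Z₁ letters) _) (cong (φₚ (π ⊗ Z₁ letters) +_) (φ-⊕ p (π ⊗ (π ⊗ Z₂ letters)) _)))) ⟩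
    φₚ (∏ₗ A letters) + (φₚ (π ⊗ Z₁ letters) + (φₚ (π ⊗ (π ⊗ Z₂ letters)) + φₚ (π ⊗ (π ⊗ (π ⊗ Z₃ letters)))))
      ≡⟨ cong₂ _+_ zeroth (cong₂ _+_ first (cong₂ _+_ second third)) ⟩
    rencontres 0 n + (p * (p * (pairs n * pairValue)) + p * (p * (p * φₚ (Z₃ letters)))) ∎
    where
    letters = allFin n
    row : ∀ b → Q b ^ p ≈ A b ⊕ π ⊗ B b
    row b = R.trans (frobenius-y (others b))
      (R.+-congˡ (R.sym (R.trans (×-assoc-* p R.1# (B b)) (×-congʳ p (R.*-identityˡ (B b))))))
    zeroth : φₚ (∏ₗ A letters) ≡ rencontres 0 n
    zeroth = trans (φ-cong p (R.sym (R.trans (R.*-identityˡ _) (R.*-identityˡ _))))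
      (trans (φ-value letters [] [] (↭-reflexive (++-identityʳ letters))) (cong (rencontres 0) (length-↭-allFin ↭-refl)))
    first : φₚ (π ⊗ Z₁ letters) ≡ 0
    first = trans (φ-π (Z₁ letters)) (trans (cong (p *_) (trans (φ-cong p (R.sym (R.*-identityˡ _))) (φ-Z₁ [] letters ↭-refl))) (ℕ.*-zeroʳ p))
    second : φₚ (π ⊗ (π ⊗ Z₂ letters)) ≡ p * (p * (pairs n * pairValue))
    second = trans (φ-π _) (cong (p *_) (trans (φ-π (Z₂ letters)) (cong (p *_)
      (trans (φ-cong p (R.sym (R.*-identityˡ _))) (trans (φ-Z₂ [] letters ↭-refl) (cong (λ k → pairs k * pairValue) (length-↭-allFin ↭-refl)))))))
    third : φₚ (π ⊗ (π ⊗ (π ⊗ Z₃ letters))) ≡ p * (p * (p * φₚ (Z₃ letters)))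
    third = trans (φ-π _) (cong (p *_) (trans (φ-π _) (cong (p *_) (φ-π (Z₃ letters)))))

-- For t = 1 the rows `A` are the rows `Q` themselves, so `φ-value` gives the same number as for the
-- order-zero term at t = p.
P′-1 : ∀ n → P′ n (λ _ → 1) ≡ rencontres 0 n
P′-1 n = begin
  P′ n (λ _ → 1)                        ≡⟨ P′-coefficient 1 ⟩
  φ 1 (∏ₗ (λ b → Q b ^ 1) (allFin n))  ≡⟨ φ-cong 1 (∏ₗ-cong (λ b → Q b ^ 1) (λ b → R.*-identityʳ (Q b)) (allFin n)) ⟩
  φ 1 (∏ₗ Q (allFin n))                 ≡⟨ φ-cong 1 (R.trans (R.*-identityˡ _) (R.*-identityˡ _)) ⟨
  φ 1 (R.1# ⊗ (R.1# ⊗ ∏ₗ Q (allFin n))) ≡⟨ Values.φ-value n 1 (allFin n) [] [] (↭-reflexive (++-identityʳ (allFin n))) ⟩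
  rencontres 0 (length (allFin n))      ≡⟨ cong (rencontres 0) (length-tabulate {n = n} (λ i → i)) ⟩
  rencontres 0 n                        ∎
  where
  open Polynomials n
  open WordCount n
  open ≡-Reasoning

open import Data.Integer using (+_; _-_)
open import Data.Nat using (_^_)
open import Data.Integer.Divisibility using (_∣_)

theorem5p1 : (p : ℕ) → Prime p → (n : ℕ) → n ≥ 1 →
    (+ (p ^ 3)) ∣ (+ (P′ n (λ _ → p)) - + (P′ n (λ _ → 1)))
theorem5p1 zero      pr n _ = contradiction pr ¬prime[0]
theorem5p1 p@(suc _) pr n _ with Assembly.p∣φ-Z₂ n pr
... | divides k eq = subst (p ^ 3 ∣ℕ_) (sym distance) (divides (k + z) (total p k z))
  where
  open Assembly n pr
  open ≡-Reasoning
  z d e : ℕ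
  z = φₚ (Z₃ (allFin n))
  d = rencontres 0 n
  e = p * (p * (k * p)) + p * (p * (p * z))
  total : ∀ p k z → p * (p * (k * p)) + p * (p * (p * z)) ≡ (k + z) * (p * (p * (p * 1)))
  total = solve-∀
  -- The count for p exceeds `d` by the natural number `e`, so the absolute value of the integer
  -- difference is `e` itself.
  distance : ℤ.∣ + (P′ n (λ _ → p)) - + (P′ n (λ _ → 1)) ∣ ≡ e
  distance = begin
    ℤ.∣ + (P′ n (λ _ → p)) - + (P′ n (λ _ → 1)) ∣  ≡⟨ cong₂ (λ u v → ℤ.∣ + u - + v ∣) (trans P′-p (cong (λ u → d + (p * (p * u) + p * (p * (p * z)))) eq)) (P′-1 n) ⟩
    ℤ.∣ + (d + e) - + d ∣                          ≡⟨ cong ℤ.∣_∣ (ℤ.[+m]-[+n]≡m⊖n (d + e) d) ⟩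
    ℤ.∣ (d + e) ℤ.⊖ d ∣                            ≡⟨ cong ℤ.∣_∣ (ℤ.⊖-≥ (ℕ.m≤m+n d e)) ⟩
    d + e ∸ d                                      ≡⟨ ℕ.m+n∸m≡n d e ⟩
    e                                              ∎
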